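{- The class of unlabelled graphs underlying an element of $\mathcal{L}_1$ coincides with the class of (non-empty) outerplanar graphs.
   Context: Graphs are finite, undirected, without multiple edges, may have loops, have at least one vertex, and are considered up to isomorphism. A graph is outerplanar if it does not have $K_4$ or $K_{2,3}$ as a minor (equivalently, it has a planar drawing such that all its vertices lie on the same face). A $(1,1)$-bilabelled graph is a tuple $\boldsymbol{F}=(F,u,v)$ with $F$ a graph and $u,v\in V(F)$ (in-label $u$, out-label $v$; $u=v$ is allowed). $F$ is its underlying unlabelled graph. The series composition $\boldsymbol{F}\cdot\boldsymbol{F}'$ of $(F,u,v)$ and $(F',u',v')$ is obtained from the disjoint union of $F$ and $F'$ by identifying $v$ with $u'$, with in-label $u$ and out-label $v'$. The parallel composition $\boldsymbol{F}\odot\boldsymbol{F}'$ is obtained from the disjoint union by identifying $u$ with $u'$ and $v$ with $v'$, with in-label $u$ and out-label $v$. Multiple edges are removed and loops are kept. The symmetric group $\mathfrak{S}_2$ acts on bilabelled graphs by permuting labels, i.e. the non-trivial element sends $(F,u,v)$ to $(F,v,u)$. A $(1,1)$-bilabelled graph is atomic if all its vertices are labelled; $\mathcal{A}_1$ is the set of atomic $(1,1)$-bilabelled graphs. $\mathcal{L}_1$ is the class of $(1,1)$-bilabelled graphs generated by $\mathcal{A}_1$ under parallel composition with graphs from $\mathcal{A}_1$, series composition, and the action of $\mathfrak{S}_2$ on the labels. -}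

module Defs where

open import Level using (0ℓ)
open import Data.Bool.Base using (Bool; true; false)
import Data.Bool.Properties as Bool
open import Data.Fin.Base using (Fin; splitAt)
import Data.Fin.Properties as Fin
open import Data.Fin.Subset using (Subset; _∈_; Nonempty)
open import Data.Nat.Base using (ℕ; _+_; NonZero)
open import Data.Product.Base using (Σ; ∃; ∃₂; _×_; _,_)
open import Data.Sum.Base using (_⊎_; inj₁; inj₂; [_,_]′)
open import Data.Sum.Relation.Binary.Pointwise using (Pointwise)
open import Function.Base using (_∘_; const)
open import Function.Bundles using (_↔_; _⇔_; Inverse)
open import Function.Definitions using (StrictlySurjective)
open import Relation.Binary.Construct.Closure.Equivalence using (EqClosure)
open import Relation.Binary.Construct.Closure.ReflexiveTransitive using (Star)
open import Relation.Binary.Core using (Rel)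
open import Relation.Binary.Definitions using (Decidable; Symmetric)
open import Relation.Binary.PropositionalEquality using (_≡_; _≢_; ≢-sym)
open import Relation.Nullary.Decidable using (¬?)
open import Relation.Nullary.Negation using (¬_)

------------------------------------------------------------------------
-- Graphs

-- Loops are allowed: _~_ is not required to be irreflexive.
-- Decidability of adjacency holds for every finite graph classically.

record Graph : Set₁ where
  infix 4 _~_ _~?_
  field
    order    : ℕ
    nonEmpty : NonZero order
    _~_      : Rel (Fin order) 0ℓ
    ~-sym    : Symmetric _~_
    _~?_     : Decidable _~_

  Vertex : Set
  Vertex = Fin order

open Graph using (Vertex)

Adj : (G : Graph) → Rel (Vertex G) 0ℓ
Adj = Graph._~_

infix 4 _≅_

record _≅_ (G H : Graph) : Set where
  field
    bijection : Vertex G ↔ Vertex H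

  open Inverse bijection public using (to; from)

  field
    adjacency : ∀ x y → Adj G x y ⇔ Adj H (to x) (to y)

------------------------------------------------------------------------
-- Outerplanarity

complete : ∀ n → {{NonZero n}} → Graph
complete n {{n≢0}} = record
  { order    = n
  ; nonEmpty = n≢0
  ; _~_      = _≢_
  ; ~-sym    = ≢-sym
  ; _~?_     = λ x y → ¬? (x Fin.≟ y)
  }

completeBipartite : ∀ m n → {{NonZero (m + n)}} → Graph
completeBipartite m n {{m+n≢0}} = record
  { order    = m + n
  ; nonEmpty = m+n≢0
  ; _~_      = λ x y → part x ≢ part y
  ; ~-sym    = ≢-sym
  ; _~?_     = λ x y → ¬? (part x Bool.≟ part y)
  }
  where
  part : Fin (m + n) → Bool
  part = [ const false , const true ]′ ∘ splitAt m

Connected : (G : Graph) → Subset (Graph.order G) → Set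
Connected G S = ∀ {x y} → x ∈ S → y ∈ S → Star Within x y
  where
  Within : Rel (Vertex G) 0ℓ
  Within x y = x ∈ S × y ∈ S × Adj G x y

-- H arises from a subgraph of G by contracting the branch sets to single
-- vertices.  This describes minors only for loopless H (such as K₄ and
-- K₂,₃): a loop of H at a would be matched by any edge inside branch a,
-- including the edges that get contracted.

record Minor (H G : Graph) : Set where
  field
    branch    : Vertex H → Subset (Graph.order G)
    nonempty  : ∀ a → Nonempty (branch a)
    connected : ∀ a → Connected G (branch a)
    disjoint  : ∀ {a b x} → x ∈ branch a → x ∈ branch b → a ≡ b
    edge      : ∀ {a b} → Adj H a b →
                ∃₂ λ x y → x ∈ branch a × y ∈ branch b × Adj G x y

Outerplanar : Graph → Set
Outerplanar G = ¬ Minor (complete 4) G × ¬ Minor (completeBipartite 2 3) G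

------------------------------------------------------------------------
-- (1,1)-bilabelled graphs

record BilabelledGraph : Set₁ where
  field
    graph    : Graph
    inLabel  : Vertex graph
    outLabel : Vertex graph

  open Graph graph public using () renaming (Vertex to V)

open BilabelledGraph

swap : BilabelledGraph → BilabelledGraph
swap F = record
  { graph    = graph F
  ; inLabel  = outLabel F
  ; outLabel = inLabel F
  }

Atomic : BilabelledGraph → Set
Atomic F = ∀ x → x ≡ inLabel F ⊎ x ≡ outLabel F

-- As graphs are taken up to isomorphism, identification of vertices in a
-- disjoint union is described by its projection map rather than by a chosen
-- numbering of the classes.  IsGluing F F′ R H q says that H is the disjoint
-- union of F and F′ modulo the equivalence relation generated by R, with
-- projection q.  An edge between identified vertices becomes a loop, and
-- parallel edges collapse since adjacency is a relation.

record IsGluing (F F′ : Graph) (R : Rel (Vertex F ⊎ Vertex F′) 0ℓ)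
                (H : Graph) (q : Vertex F ⊎ Vertex F′ → Vertex H) : Set where
  field
    surjective : StrictlySurjective _≡_ q
    identifies : ∀ x y → q x ≡ q y ⇔ EqClosure R x y
    adjacency  : ∀ a b → Adj H a b ⇔
                 (∃₂ λ x y → q x ≡ a × q y ≡ b × Pointwise (Adj F) (Adj F′) x y)

data SeriesId (F F′ : BilabelledGraph) : Rel (V F ⊎ V F′) 0ℓ where
  out-in : SeriesId F F′ (inj₁ (outLabel F)) (inj₂ (inLabel F′))

data ParallelId (F F′ : BilabelledGraph) : Rel (V F ⊎ V F′) 0ℓ where
  in-in   : ParallelId F F′ (inj₁ (inLabel F)) (inj₂ (inLabel F′))
  out-out : ParallelId F F′ (inj₁ (outLabel F)) (inj₂ (outLabel F′))

record IsSeries (F F′ H : BilabelledGraph) : Set where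
  field
    proj     : V F ⊎ V F′ → V H
    isGluing : IsGluing (graph F) (graph F′) (SeriesId F F′) (graph H) proj
    in-eq    : inLabel H ≡ proj (inj₁ (inLabel F))
    out-eq   : outLabel H ≡ proj (inj₂ (outLabel F′))

record IsParallel (F F′ H : BilabelledGraph) : Set where
  field
    proj     : V F ⊎ V F′ → V H
    isGluing : IsGluing (graph F) (graph F′) (ParallelId F F′) (graph H) proj
    in-eq    : inLabel H ≡ proj (inj₁ (inLabel F))
    out-eq   : outLabel H ≡ proj (inj₁ (outLabel F))

-- Each composition constructor quantifies over every H that realises the
-- composition, so the class is closed under isomorphism.

data L₁ : BilabelledGraph → Set₁ where
  atomic   : ∀ {F} → Atomic F → L₁ F
  parallel : ∀ {F A H} → L₁ F → Atomic A → IsParallel F A H → L₁ H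
  series   : ∀ {F F′ H} → L₁ F → L₁ F′ → IsSeries F F′ H → L₁ H
  permute  : ∀ {F} → L₁ F → L₁ (swap F)

UnderliesL₁ : Graph → Set₁
UnderliesL₁ G = Σ BilabelledGraph λ F → L₁ F × graph F ≅ G

{-# OPTIONS --safe #-}
-- From L₁ to outerplanar: every (F , u , v) in L₁ admits a linear order of its vertices in which no two
-- edges cross, u comes first and, if v ≢ u, v comes last; series composition concatenates such orders.
-- Without crossing edges, disjoint connected sets do not interleave.  A K₄ or K₂,₃ minor provides four
-- vertices such that for each of their three pairings disjoint connected sets contain the two pairs; the
-- pairing that alternates along the order is impossible.
--
-- From outerplanar to L₁: by induction on S, each induced subgraph (G[S] , u , u) is in L₁, and so is
-- (G[S] , u , v) if a connected set outside S is adjacent to both u and v.  In the latter case delete the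
-- edge uv: by Menger, either some vertex separates u from v, which gives a series decomposition, or two
-- disjoint paths join them, which together with the outside set form K₂,₃.  In the former case
-- K₄-freeness yields a neighbour a of u such that G[S] − au decomposes in series between a and u; the
-- edge au is put back by prepending it to (G[S] − au , a , u) and then identifying the two labels.
module Submission where

open import Defs
open import Data.Empty using (⊥; ⊥-elim)
open import Data.Fin.Base as Fin using (Fin; zero; suc; splitAt)
open import Data.Fin.Patterns
import Data.Fin.Properties as Fin
open import Data.Fin.Subset
  using (Subset; _∈_; _∉_; _⊆_; _⊂_; _⊃_; _∪_; ⁅_⁆; Nonempty; inside; outside)
  renaming (⊥ to ∅)
open import Data.Fin.Subset.Induction using (⊂-wellFounded; ⊃-wellFounded)
open import Data.Fin.Subset.Properties
  using (_∈?_; x∈p∪q⁻; x∈p∪q⁺; x∈⁅x⁆; x∈⁅y⁆⇒x≡y; ∈⊤; ∉⊥)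
open import Data.Nat.Base using (ℕ; zero; suc; _+_; _∸_; _⊔_; _<_; _≤_; z≤n; s≤s; NonZero)
import Data.Nat.Properties as ℕ
open import Data.Product.Base using (Σ; ∃; ∃₂; _×_; _,_; proj₁; proj₂; map₂)
open import Data.Sum.Base as Sum using (_⊎_; inj₁; inj₂; [_,_]; [_,_]′)
import Data.Sum.Properties as Sum
open import Data.Sum.Relation.Binary.Pointwise using (Pointwise; inj₁; inj₂)
open import Data.Vec.Base using ([]; _∷_; here; there; tabulate)
open import Data.Vec.Properties using (lookup∘tabulate; []=⇒lookup; lookup⇒[]=)
open import Function.Base using (_∘_; id)
open import Function.Bundles using (_⇔_; Equivalence; Inverse; mk⇔; mk↔ₛ′)
open import Function.Construct.Identity using (⇔-id)
open import Induction.WellFounded using (Acc; acc)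
open import Level using (0ℓ)
import Relation.Binary.Construct.Closure.Equivalence as EqC
open EqC using (EqClosure)
open import Relation.Binary.Construct.Closure.ReflexiveTransitive as Star using (Star; ε; _◅_; _◅◅_)
open import Relation.Binary.Core using (Rel)
open import Relation.Binary.Definitions using (Decidable; Symmetric; tri<; tri≈; tri>)
open import Relation.Binary.PropositionalEquality
  using (_≡_; _≢_; refl; sym; trans; cong; subst; subst₂; isEquivalence)
open import Relation.Nullary.Decidable
  using (Dec; yes; no; does; ¬?; _×-dec_; decidable-stable; dec-true)
open import Relation.Nullary.Negation.Core using (¬_; contradiction)

open Graph using (Vertex; order)
open BilabelledGraph using (graph; inLabel; outLabel; V)

-- The two labels cannot be chosen freely: the four-cycle with opposite labels has no noncrossing
-- order that starts at one label and ends at the other, so it is not in `L₁`. The connected set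
-- outside S rules such labels out, since with the two paths it would form K₂,₃. At a cut vertex
-- each half inherits an outside set: the component on the far side, extended by the old outside set
-- or attached through the edge `uv`. When both labels are u there is no outside set, and the
-- removed edge `au` takes over its role. But `au` together with two further paths is only a cycle
-- with a chord, which is outerplanar, so not every neighbour of u will do. K₄-freeness puts the two
-- paths into different components of S minus a and u; moving to a neighbour of u in a component
-- that avoids the previous choice makes the components shrink, so the search ends. For vertex
-- orders the obstacle is coinciding labels: a vertex that comes first cannot also come last, so
-- mergers of labels have to be treated separately in each composition.

Within : (G : Graph) → Subset (order G) → Rel (Vertex G) 0ℓ
Within G S x y = x ∈ S × y ∈ S × Adj G x y

Disjoint : ∀ {n} → Subset n → Subset n → Set
Disjoint A B = ∀ {x} → x ∈ A → x ∉ B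

disjoint-sym : ∀ {n} {A B : Subset n} → Disjoint A B → Disjoint B A
disjoint-sym A∩B x∈B x∈A = A∩B x∈A x∈B

disjoint-∪ˡ : ∀ {n} {A B C : Subset n} → Disjoint A C → Disjoint B C → Disjoint (A ∪ B) C
disjoint-∪ˡ {A = A} {B} A∩C B∩C x∈ = [ A∩C , B∩C ]′ (x∈p∪q⁻ A B x∈)

disjoint-∪ʳ : ∀ {n} {A B C : Subset n} → Disjoint A B → Disjoint A C → Disjoint A (B ∪ C)
disjoint-∪ʳ A∩B A∩C = disjoint-sym (disjoint-∪ˡ (disjoint-sym A∩B) (disjoint-sym A∩C))

module _ {G : Graph} where

  within-mono : ∀ {S T x y} → S ⊆ T → Star (Within G S) x y → Star (Within G T) x y
  within-mono S⊆T = Star.map λ (x∈S , y∈S , x~y) → S⊆T x∈S , S⊆T y∈S , x~y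

  within-reverse : ∀ {S x y} → Star (Within G S) x y → Star (Within G S) y x
  within-reverse = Star.reverse λ (x∈S , y∈S , x~y) → y∈S , x∈S , Graph.~-sym G x~y

  connected-∪ : ∀ {A B} → Connected G A → Connected G B →
                ∃₂ (λ a b → a ∈ A × b ∈ B × Adj G a b) → Connected G (A ∪ B)
  connected-∪ {A} {B} cA cB (a , b , a∈A , b∈B , a~b) = walk
    where
    A⊆ : A ⊆ A ∪ B
    A⊆ = x∈p∪q⁺ ∘ inj₁
    B⊆ : B ⊆ A ∪ B
    B⊆ = x∈p∪q⁺ ∘ inj₂
    across : ∀ {x y} → x ∈ A → y ∈ B → Star (Within G (A ∪ B)) x y
    across x∈A y∈B =
      within-mono A⊆ (cA x∈A a∈A) ◅◅ (A⊆ a∈A , B⊆ b∈B , a~b) ◅ within-mono B⊆ (cB b∈B y∈B)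
    walk : Connected G (A ∪ B)
    walk {x} {y} x∈ y∈ with x∈p∪q⁻ A B x∈ | x∈p∪q⁻ A B y∈
    ... | inj₁ x∈A | inj₁ y∈A = within-mono A⊆ (cA x∈A y∈A)
    ... | inj₁ x∈A | inj₂ y∈B = across x∈A y∈B
    ... | inj₂ x∈B | inj₁ y∈A = within-reverse (across y∈A x∈B)
    ... | inj₂ x∈B | inj₂ y∈B = within-mono B⊆ (cB x∈B y∈B)

-- Noncrossing vertex orders

-- Only the relative order of positions matters, so gaps are harmless. The inequalities are strict:
-- loops and edges with a common end never cross.
record Layout (G : Graph) : Set where
  field
    pos         : Vertex G → ℕ
    injective   : ∀ {x y} → pos x ≡ pos y → x ≡ y
    noncrossing : ∀ {a b c d} → Adj G a c → Adj G b d →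
                  pos a < pos b → pos b < pos c → pos c < pos d → ⊥

module _ {G : Graph} (L : Layout G) where
  open Layout L
  open Graph G using (_~_; ~-sym)

  _before_ : Rel (Vertex G) 0ℓ
  x before y = pos x < pos y

  data Cmp (x y : Vertex G) : Set where
    lt : x before y → Cmp x y
    eq : x ≡ y → Cmp x y
    gt : y before x → Cmp x y

  compare : ∀ x y → Cmp x y
  compare x y with ℕ.<-cmp (pos x) (pos y)
  ... | tri< p _ _ = lt p
  ... | tri≈ _ p _ = eq (injective p)
  ... | tri> _ _ p = gt p

  -- A step of the walk out of the open interval from `l` to `r` would land on `l` or `r`, which are
  -- not in `B`, or would cross the edge `l ~ r`.
  edge-confines : ∀ {l r B b b′} → l ~ r → l ∉ B → r ∉ B → Star (Within G B) b b′ →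
                  l before b → b before r → l before b′ × b′ before r
  edge-confines l~r l∉ r∉ ε l<b b<r = l<b , b<r
  edge-confines {l} {r} {B} l~r l∉ r∉ (_◅_ {j = c} (b∈ , c∈ , b~c) w) l<b b<r
    with compare l c | compare c r
  ... | lt l<c | lt c<r = edge-confines l~r l∉ r∉ w l<c c<r
  ... | eq refl | _ = contradiction c∈ l∉
  ... | gt c<l | _ = ⊥-elim (noncrossing (~-sym b~c) l~r c<l l<b b<r)
  ... | lt _ | eq refl = contradiction c∈ r∉
  ... | lt _ | gt r<c = ⊥-elim (noncrossing l~r b~c l<b b<r r<c)

  -- If a step `x ~ y` jumped over `b` or `b′`, then by `edge-confines` all of `B` would lie
  -- strictly between `x` and `y`. But `x` itself lies between `b` and `b′`.
  walk-confines : ∀ {A B b b′ x y} → Connected G B → b ∈ B → b′ ∈ B → Disjoint A B →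
                  Star (Within G A) x y → b before x → x before b′ → b before y × y before b′
  walk-confines cB b∈ b′∈ A∩B ε b<x x<b′ = b<x , x<b′
  walk-confines {b = b} {b′} cB b∈ b′∈ A∩B (_◅_ {j = y} (x∈ , y∈ , x~y) w) b<x x<b′
    with compare b y | compare y b′
  ... | lt b<y | lt y<b′ = walk-confines cB b∈ b′∈ A∩B w b<y y<b′
  ... | eq refl | _ = contradiction b∈ (A∩B y∈)
  ... | lt _ | eq refl = contradiction b′∈ (A∩B y∈)
  ... | gt y<b | _ = contradiction x<b′ (ℕ.<-asym
        (proj₂ (edge-confines (~-sym x~y) (A∩B y∈) (A∩B x∈) (cB b∈ b′∈) y<b b<x)))
  ... | lt _ | gt b′<y = contradiction b<x (ℕ.<-asym
        (proj₁ (edge-confines x~y (A∩B x∈) (A∩B y∈) (cB b′∈ b∈) x<b′ b′<y)))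

-- Four vertices with separated pairings

record Separated (G : Graph) (p q r s : Vertex G) : Set where
  field
    {left right}    : Subset (order G)
    left-connected  : Connected G left
    right-connected : Connected G right
    disjoint        : Disjoint left right
    p∈left          : p ∈ left
    q∈left          : q ∈ left
    r∈right         : r ∈ right
    s∈right         : s ∈ right

module _ {G : Graph} where

  separated-swapˡ : ∀ {p q r s} → Separated G p q r s → Separated G q p r s
  separated-swapˡ S = record { Separated S ; p∈left = Separated.q∈left S ; q∈left = Separated.p∈left S }

  separated-flip : ∀ {p q r s} → Separated G p q r s → Separated G r s p q
  separated-flip S = record
    { left-connected = right-connected ; right-connected = left-connected
    ; disjoint = disjoint-sym disjoint
    ; p∈left = r∈right ; q∈left = s∈right ; r∈right = p∈left ; s∈right = q∈left }
    where open Separated S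

  separated-swapʳ : ∀ {p q r s} → Separated G p q r s → Separated G p q s r
  separated-swapʳ = separated-flip ∘ separated-swapˡ ∘ separated-flip

  -- A K₄ or K₂,₃ minor yields four vertices all of whose pairings are separated.
  record FullySeparated (p q r s : Vertex G) : Set where
    constructor mk
    field
      pq|rs : Separated G p q r s
      pr|qs : Separated G p r q s
      ps|qr : Separated G p s q r

  private
    -- Permuting the four vertices only permutes the three pairings; adjacent transpositions are
    -- enough to sort.
    swap₁₂ : ∀ {p q r s} → FullySeparated p q r s → FullySeparated q p r s
    swap₁₂ (mk a b c) = mk (separated-swapˡ a) (separated-flip c) (separated-flip b)
    swap₂₃ : ∀ {p q r s} → FullySeparated p q r s → FullySeparated p r q s
    swap₂₃ (mk a b c) = mk b a (separated-swapʳ c)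
    swap₃₄ : ∀ {p q r s} → FullySeparated p q r s → FullySeparated p q s r
    swap₃₄ (mk a b c) = mk (separated-swapʳ a) c b

  module _ (L : Layout G) where
    open Separated
    private
      _≺_ = _before_ L

      distinct : ∀ {p q r} → ¬ Separated G p q p r
      distinct S = disjoint S (p∈left S) (r∈right S)

      -- In the alternating pairing a walk in the left set leads from `r`, between `q` and `s`, to
      -- `p`, before `q`. By `walk-confines` for the right set it could not have left the interval.
      sorted : ∀ {p q r s} → p ≺ q → q ≺ r → r ≺ s → ¬ FullySeparated p q r s
      sorted p<q q<r r<s F = ℕ.<-asym p<q (proj₁
        (walk-confines L (right-connected S) (r∈right S) (s∈right S) (disjoint S)
          (left-connected S (q∈left S) (p∈left S)) q<r r<s))
        where S = FullySeparated.pr|qs F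

      -- Insertion sort of the four positions.
      insert₃ : ∀ {p q r s} → p ≺ q → q ≺ r → ¬ FullySeparated p q r s
      insert₃ {p} {q} {r} {s} p<q q<r F with compare L r s | compare L q s | compare L p s
      ... | lt r<s | _ | _ = sorted p<q q<r r<s F
      ... | gt s<r | lt q<s | _ = sorted p<q q<s s<r (swap₃₄ F)
      ... | gt s<r | gt s<q | lt p<s = sorted p<s s<q q<r (swap₂₃ (swap₃₄ F))
      ... | gt s<r | gt s<q | gt s<p = sorted s<p p<q q<r (swap₁₂ (swap₂₃ (swap₃₄ F)))
      ... | eq refl | _ | _ = distinct (separated-swapˡ (separated-swapʳ (FullySeparated.pr|qs F)))
      ... | gt _ | eq refl | _ = distinct (separated-swapˡ (separated-swapʳ (FullySeparated.pq|rs F)))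
      ... | gt _ | gt _ | eq refl = distinct (separated-swapʳ (FullySeparated.pq|rs F))

      insert₂ : ∀ {p q r s} → p ≺ q → ¬ FullySeparated p q r s
      insert₂ {p} {q} {r} {s} p<q F with compare L q r | compare L p r
      ... | lt q<r | _ = insert₃ p<q q<r F
      ... | gt r<q | lt p<r = insert₃ p<r r<q (swap₂₃ F)
      ... | gt r<q | gt r<p = insert₃ r<p p<q (swap₁₂ (swap₂₃ F))
      ... | eq refl | _ = distinct (separated-swapˡ (FullySeparated.pq|rs F))
      ... | gt _ | eq refl = distinct (FullySeparated.pq|rs F)

    ¬fullySeparated : ∀ {p q r s} → ¬ FullySeparated p q r s
    ¬fullySeparated {p} {q} F with compare L p q
    ... | lt p<q = insert₂ p<q F
    ... | gt q<p = insert₂ q<p (swap₁₂ F)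
    ... | eq refl = distinct (FullySeparated.pr|qs F)

-- Separated vertices from K₄ and K₂,₃ minors

module _ {H G : Graph} (M : Minor H G) where
  open Minor M

  private
    rep : Vertex H → Vertex G
    rep a = proj₁ (nonempty a)

    rep∈ : ∀ a → rep a ∈ branch a
    rep∈ a = proj₂ (nonempty a)

    pair : Vertex H → Vertex H → Subset (order G)
    pair a b = branch a ∪ branch b

    pair-connected : ∀ {a b} → Adj H a b → Connected G (pair a b)
    pair-connected a~b = connected-∪ {G} (connected _) (connected _) (edge a~b)

    branches-disjoint : ∀ {a b} → a ≢ b → Disjoint (branch a) (branch b)
    branches-disjoint a≢b x∈a x∈b = a≢b (disjoint x∈a x∈b)

    pairs-disjoint : ∀ {a b c d} → a ≢ c → a ≢ d → b ≢ c → b ≢ d → Disjoint (pair a b) (pair c d)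
    pairs-disjoint a≢c a≢d b≢c b≢d = disjoint-∪ˡ
      (disjoint-∪ʳ (branches-disjoint a≢c) (branches-disjoint a≢d))
      (disjoint-∪ʳ (branches-disjoint b≢c) (branches-disjoint b≢d))

    left∈ : ∀ {a} {B : Subset (order G)} → rep a ∈ branch a ∪ B
    left∈ {a} = x∈p∪q⁺ (inj₁ (rep∈ a))

    right∈ : ∀ {a} {B : Subset (order G)} → rep a ∈ B ∪ branch a
    right∈ {a} = x∈p∪q⁺ (inj₂ (rep∈ a))

  separated-edges : ∀ {a b c d} → Adj H a b → Adj H c d → a ≢ c → a ≢ d → b ≢ c → b ≢ d →
                    Separated G (rep a) (rep b) (rep c) (rep d)
  separated-edges a~b c~d a≢c a≢d b≢c b≢d = record
    { left-connected = pair-connected a~b ; right-connected = pair-connected c~d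
    ; disjoint = pairs-disjoint a≢c a≢d b≢c b≢d
    ; p∈left = left∈ ; q∈left = right∈ ; r∈right = left∈ ; s∈right = right∈ }

  -- Vertices on the same side of K₂,₃ are not adjacent, so `c` and `d` are joined through a common
  -- neighbour `e`.
  separated-cherry : ∀ {a b c d e} → Adj H a b → Adj H c e → Adj H e d →
                     a ≢ c → a ≢ d → a ≢ e → b ≢ c → b ≢ d → b ≢ e →
                     Separated G (rep a) (rep b) (rep c) (rep d)
  separated-cherry {c = c} {d} {e} a~b c~e e~d a≢c a≢d a≢e b≢c b≢d b≢e = record
    { left-connected = pair-connected a~b
    ; right-connected = connected-∪ {G} (connected c) (pair-connected e~d)
        (let (x , y , x∈ , y∈ , x~y) = edge c~e in x , y , x∈ , x∈p∪q⁺ (inj₁ y∈) , x~y)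
    ; disjoint = disjoint-∪ʳ (disjoint-∪ˡ (branches-disjoint a≢c) (branches-disjoint b≢c))
                             (pairs-disjoint a≢e a≢d b≢e b≢d)
    ; p∈left = left∈ ; q∈left = right∈ ; r∈right = left∈ ; s∈right = x∈p∪q⁺ (inj₂ right∈) }

layout⇒outerplanar : ∀ {G} → Layout G → Outerplanar G
layout⇒outerplanar {G} L = ¬K₄ , ¬K₂,₃
  where
  ¬K₄ : ¬ Minor (complete 4) G
  ¬K₄ M = ¬fullySeparated L (mk
    (sep {0F} {1F} {2F} {3F} (λ ()) (λ ()) (λ ()) (λ ()) (λ ()) (λ ()))
    (sep {0F} {2F} {1F} {3F} (λ ()) (λ ()) (λ ()) (λ ()) (λ ()) (λ ()))
    (sep {0F} {3F} {1F} {2F} (λ ()) (λ ()) (λ ()) (λ ()) (λ ()) (λ ())))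
    where sep = separated-edges M
  ¬K₂,₃ : ¬ Minor (completeBipartite 2 3) G
  -- The four vertices are `1F` from the side of size two and the whole side of size three; the
  -- remaining vertex `0F` is the centre of every cherry.
  ¬K₂,₃ M = ¬fullySeparated L (mk
    (sep {1F} {2F} {3F} {4F} {0F} (λ ()) (λ ()) (λ ()) (λ ()) (λ ()) (λ ()) (λ ()) (λ ()) (λ ()))
    (sep {1F} {3F} {2F} {4F} {0F} (λ ()) (λ ()) (λ ()) (λ ()) (λ ()) (λ ()) (λ ()) (λ ()) (λ ()))
    (sep {1F} {4F} {2F} {3F} {0F} (λ ()) (λ ()) (λ ()) (λ ()) (λ ()) (λ ()) (λ ()) (λ ()) (λ ())))
    where sep = separated-cherry M

-- Vertex orders of the graphs in L₁

-- If the labels coincide, the out-label is already first, and asking it to be last as well would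
-- leave room for one vertex only.
record BiLayout (F : BilabelledGraph) : Set where
  field
    layout : Layout (graph F)

  open Layout layout public

  field
    in-min  : ∀ x → pos (inLabel F) ≤ pos x
    out-max : inLabel F ≢ outLabel F → ∀ x → pos x ≤ pos (outLabel F)

Noncrossing : {A : Set} → Rel A 0ℓ → (A → ℕ) → Set
Noncrossing _~_ κ = ∀ {a b c d} → a ~ c → b ~ d → κ a < κ b → κ b < κ c → κ c < κ d → ⊥

module _ {F F′ H : Graph} {R : Rel (Vertex F ⊎ Vertex F′) 0ℓ} {q : Vertex F ⊎ Vertex F′ → Vertex H}
         (gluing : IsGluing F F′ R H q) where
  open IsGluing gluing

  identify : ∀ {x y} → EqClosure R x y → q x ≡ q y
  identify = Equivalence.from (identifies _ _)

  -- Positions on the disjoint union that tie exactly the glued vertices descend to the quotient.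
  -- `κ` is constant on classes, so any preimage may be used to read off a position.
  gluing-layout : (κ : Vertex F ⊎ Vertex F′ → ℕ) → (∀ {x y} → R x y → κ x ≡ κ y) →
                  (∀ x y → κ x ≡ κ y → EqClosure R x y) → Noncrossing (Pointwise (Adj F) (Adj F′)) κ →
                  ∃ λ (L : Layout H) → ∀ x → Layout.pos L (q x) ≡ κ x
  gluing-layout κ respects separates κ-noncrossing = record
    { pos = pos
    ; injective = λ {x} {y} e → trans (sym (proj₂ (surjective x)))
        (trans (identify (separates _ _ e)) (proj₂ (surjective y)))
    ; noncrossing = noncrossing
    } , pos-q
    where
    pos : Vertex H → ℕ
    pos h = κ (proj₁ (surjective h))
    pos-q : ∀ x → pos (q x) ≡ κ x
    pos-q x = EqC.gfold isEquivalence κ respects (Equivalence.to (identifies _ _) (proj₂ (surjective (q x))))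
    noncrossing : Noncrossing (Adj H) pos
    noncrossing a~c b~d with Equivalence.to (adjacency _ _) a~c | Equivalence.to (adjacency _ _) b~d
    ... | x , z , refl , refl , x~z | y , w , refl , refl , y~w
      rewrite pos-q x | pos-q y | pos-q z | pos-q w = κ-noncrossing x~z y~w

-- There are at most two vertices, hence two positions, whereas crossing edges occupy four.
atomic-layout : ∀ {F} → Atomic F → BiLayout F
atomic-layout {F} F-atomic = record
  { layout = record { pos = pos ; injective = λ {x} {y} → injective x y ; noncrossing = noncrossing }
  ; in-min = λ x → ℕ.≤-trans (ℕ.≤-reflexive pos-in) z≤n
  ; out-max = λ in≢out x → ℕ.≤-trans (pos≤1 x) (ℕ.≤-reflexive (sym (pos-other (in≢out ∘ sym))))
  }
  where
  pos : V F → ℕ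
  pos x with x Fin.≟ inLabel F
  ... | yes _ = 0
  ... | no _ = 1
  pos≤1 : ∀ x → pos x ≤ 1
  pos≤1 x with x Fin.≟ inLabel F
  ... | yes _ = z≤n
  ... | no _ = s≤s z≤n
  pos-in : pos (inLabel F) ≡ 0
  pos-in with inLabel F Fin.≟ inLabel F
  ... | yes _ = refl
  ... | no in≢in = contradiction refl in≢in
  pos-other : ∀ {x} → x ≢ inLabel F → pos x ≡ 1
  pos-other {x} x≢in with x Fin.≟ inLabel F
  ... | yes x≡in = contradiction x≡in x≢in
  ... | no _ = refl
  injective : ∀ x y → pos x ≡ pos y → x ≡ y
  injective x y e with x Fin.≟ inLabel F | y Fin.≟ inLabel F | F-atomic x | F-atomic y
  ... | yes p | yes p′ | _ | _ = trans p (sym p′)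
  ... | no p | no _ | inj₁ x≡ | _ = contradiction x≡ p
  ... | no _ | no p | _ | inj₁ y≡ = contradiction y≡ p
  ... | no _ | no _ | inj₂ x≡ | inj₂ y≡ = trans x≡ (sym y≡)
  noncrossing : Noncrossing (Adj (graph F)) pos
  noncrossing {d = d} _ _ _ b<c c<d = ℕ.<⇒≱ (ℕ.≤-<-trans (ℕ.≤-<-trans z≤n b<c) c<d) (pos≤1 d)

-- Reversing the order exchanges first and last place. The out-label has the largest position, so
-- subtracting from it never truncates.
swap-layout : ∀ {F} → BiLayout F → BiLayout (swap F)
swap-layout {F} L with inLabel F Fin.≟ outLabel F
... | yes in≡out = record
  { layout = layout
  ; in-min = subst (λ v → ∀ x → pos v ≤ pos x) in≡out in-min
  ; out-max = λ out≢in → contradiction (sym in≡out) out≢in }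
  where open BiLayout L
... | no in≢out = record
  { layout = record
    { pos = λ x → top ∸ pos x
    ; injective = λ e → injective (ℕ.∸-cancelˡ-≡ (≤top _) (≤top _) e)
    ; noncrossing = λ a~c b~d a<b b<c c<d →
        noncrossing (~-sym b~d) (~-sym a~c) (reverse c<d) (reverse b<c) (reverse a<b)
    }
  ; in-min = λ x → ℕ.∸-monoʳ-≤ top (≤top x)
  ; out-max = λ _ x → ℕ.∸-monoʳ-≤ top (in-min x)
  }
  where
  open BiLayout L
  open Graph (graph F) using (~-sym)
  top : ℕ
  top = pos (outLabel F)
  ≤top : ∀ x → pos x ≤ top
  ≤top = out-max in≢out
  reverse : ∀ {m n} → top ∸ m < top ∸ n → n < m
  reverse m<n = ℕ.≰⇒> λ m≤n → ℕ.<⇒≱ m<n (ℕ.∸-monoʳ-≤ top m≤n)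

-- Parallel composition with an atomic graph

module _ {F A H : BilabelledGraph} (L : BiLayout F) (A-atomic : Atomic A) (P : IsParallel F A H) where
  open BiLayout L
  open IsParallel P
  private
    u v : V F
    u = inLabel F
    v = outLabel F

    _≈_ : Rel (V F ⊎ V A) 0ℓ
    _≈_ = EqClosure (ParallelId F A)

    Edge : Rel (V F ⊎ V A) 0ℓ
    Edge = Pointwise (Adj (graph F)) (Adj (graph A))

    below-u : ∀ {x} → ¬ pos x < pos u
    below-u {x} = ℕ.≤⇒≯ (in-min x)

    -- Every vertex of the atomic `A` is glued to a label of `F`, so each class has a representative
    -- in `F`. `ρ` selects one, and `H` is ordered by the positions of the representatives. `ρ-out`
    -- tells whether the labels have merged.
    record Retraction : Set where
      field
        ρ           : V F ⊎ V A → V F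
        respects    : ∀ {x y} → ParallelId F A x y → ρ x ≡ ρ y
        retracts    : ∀ x → x ≈ inj₁ (ρ x)
        ρ-in        : ρ (inj₁ u) ≡ u
        ρ-out       : ρ (inj₁ v) ≡ u ⊎ ρ (inj₁ v) ≡ v × u ≢ v
        noncrossing : Noncrossing Edge (pos ∘ ρ)

    retraction-layout : Retraction → BiLayout H
    retraction-layout r = record
      { layout = L′
      ; in-min = λ x → subst (_≤ pos′ x) (sym pos-in) (lower x)
      ; out-max = out-max′
      }
      where
      open Retraction r renaming (noncrossing to ρ-noncrossing)
      descended = gluing-layout isGluing (pos ∘ ρ) (cong pos ∘ respects)
        (λ x y e → retracts x ◅◅ subst (λ z → inj₁ z ≈ y) (sym (injective e)) (EqC.symmetric _ (retracts y)))
        ρ-noncrossing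
      L′ = proj₁ descended
      open Layout L′ renaming (pos to pos′; injective to injective′) using ()
      pos-q = proj₂ descended
      pos-in : pos′ (inLabel H) ≡ pos u
      pos-in = trans (cong pos′ in-eq) (trans (pos-q _) (cong pos ρ-in))
      lift : ∀ x → ∃ λ z → pos′ x ≡ pos z
      lift x = let (z , e) = IsGluing.surjective isGluing x in ρ z , trans (cong pos′ (sym e)) (pos-q z)
      lower : ∀ x → pos u ≤ pos′ x
      lower x = let (z , e) = lift x in subst (pos u ≤_) (sym e) (in-min z)
      out-max′ : inLabel H ≢ outLabel H → ∀ x → pos′ x ≤ pos′ (outLabel H)
      out-max′ in≢out x with ρ-out
      ... | inj₁ out≡u = contradiction (injective′ (trans pos-in (sym
              (trans (cong pos′ out-eq) (trans (pos-q _) (cong pos out≡u)))))) in≢out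
      ... | inj₂ (out≡v , u≢v) = let (z , e) = lift x in
              subst₂ _≤_ (sym e) (sym (trans (cong pos′ out-eq) (trans (pos-q _) (cong pos out≡v))))
                (out-max u≢v z)

    -- The two labels end up identified: out-label vertices move to the in-label.
    collapse : inj₁ u ≈ inj₁ v → Retraction
    collapse u≈v = record
      { ρ = ρ
      ; respects = λ { in-in → move-u ; out-out → move-v }
      ; retracts = retracts
      ; ρ-in = move-u
      ; ρ-out = inj₁ move-v
      ; noncrossing = noncrossing′
      }
      where
      move : V F → V F
      move x with x Fin.≟ v
      ... | yes _ = u
      ... | no _ = x
      move-u : move u ≡ u
      move-u with u Fin.≟ v
      ... | yes _ = refl
      ... | no _ = refl
      move-v : move v ≡ u
      move-v with v Fin.≟ v
      ... | yes _ = refl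
      ... | no v≢v = contradiction refl v≢v
      ρ : V F ⊎ V A → V F
      ρ = [ move , (λ _ → u) ]′
      retracts : ∀ x → x ≈ inj₁ (ρ x)
      retracts (inj₁ x) with x Fin.≟ v
      ... | yes refl = EqC.symmetric _ u≈v
      ... | no _ = ε
      retracts (inj₂ y) with A-atomic y
      ... | inj₁ refl = EqC.symmetric _ (EqC.return in-in)
      ... | inj₂ refl = EqC.symmetric _ (u≈v ◅◅ EqC.return out-out)
      fixed : ∀ x → pos u < pos (move x) → move x ≡ x × x ≢ v
      fixed x u<x with x Fin.≟ v
      ... | yes _ = contradiction u<x (ℕ.<-irrefl refl)
      ... | no x≢v = refl , x≢v
      -- Moving `v` from the last place to the first preserves the cyclic order. If the edge from
      -- `v` to `z`, now starting at `u`, crosses `y ~ w`, then already in `F` the edges `y ~ w` and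
      -- `z ~ v` cross, because `v` comes after `w`.
      rotated : ∀ {x y z w} → Adj (graph F) x z → Adj (graph F) y w → y ≢ v → w ≢ v →
                pos (move x) < pos y → pos y < pos z → pos z < pos w → ⊥
      rotated {x} {w = w} x~z y~w y≢v w≢v x<y y<z z<w with x Fin.≟ v
      ... | no _ = noncrossing x~z y~w x<y y<z z<w
      ... | yes refl with u Fin.≟ v
      ...   | yes u≡v = noncrossing x~z y~w (subst (λ t → pos t < _) u≡v x<y) y<z z<w
      ...   | no u≢v = noncrossing y~w (Graph.~-sym (graph F) x~z) y<z z<w
                (ℕ.≤∧≢⇒< (out-max u≢v w) (w≢v ∘ injective))
      noncrossing′ : Noncrossing Edge (pos ∘ ρ)
      noncrossing′ {inj₁ x} {inj₁ y} {inj₁ z} {inj₁ w} (inj₁ x~z) (inj₁ y~w) x<y y<z z<w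
        with fixed y (ℕ.≤-<-trans (in-min _) x<y) | fixed z (ℕ.≤-<-trans (in-min _) y<z)
           | fixed w (ℕ.≤-<-trans (in-min _) z<w)
      ... | y≡ , y≢v | z≡ , _ | w≡ , w≢v = rotated {x} {y} {z} {w} x~z y~w y≢v w≢v
              (subst (λ t → _ < pos t) y≡ x<y) (subst₂ (λ s t → pos s < pos t) y≡ z≡ y<z)
              (subst₂ (λ s t → pos s < pos t) z≡ w≡ z<w)
      noncrossing′ (inj₂ _) _ _ y<z _ = below-u y<z
      noncrossing′ (inj₁ _) (inj₂ _) x<y _ _ = below-u x<y

    -- The ends of an edge of `A` are placed at `u` or `v`, the extremes of the order, whereas each
    -- of two crossing edges has an end strictly between the ends of the other.
    keep : u ≢ v → inLabel A ≢ outLabel A → Retraction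
    keep u≢v i≢o = record
      { ρ = ρ
      ; respects = λ { in-in → sym place-in ; out-out → sym place-out }
      ; retracts = retracts
      ; ρ-in = refl
      ; ρ-out = inj₂ (refl , u≢v)
      ; noncrossing = noncrossing′
      }
      where
      place : V A → V F
      place y with y Fin.≟ inLabel A
      ... | yes _ = u
      ... | no _ = v
      place-in : place (inLabel A) ≡ u
      place-in with inLabel A Fin.≟ inLabel A
      ... | yes _ = refl
      ... | no i≢i = contradiction refl i≢i
      place-out : place (outLabel A) ≡ v
      place-out with outLabel A Fin.≟ inLabel A
      ... | yes o≡i = contradiction (sym o≡i) i≢o
      ... | no _ = refl
      ρ : V F ⊎ V A → V F
      ρ = [ id , place ]′
      retracts : ∀ x → x ≈ inj₁ (ρ x)
      retracts (inj₁ x) = ε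
      retracts (inj₂ y) with y Fin.≟ inLabel A | A-atomic y
      ... | yes refl | _ = EqC.symmetric _ (EqC.return in-in)
      ... | no y≢i | inj₁ y≡i = contradiction y≡i y≢i
      ... | no _ | inj₂ refl = EqC.symmetric _ (EqC.return out-out)
      extreme : ∀ {x z} y → pos x < pos (place y) → ¬ pos (place y) < pos z
      extreme y x<y y<z with y Fin.≟ inLabel A
      ... | yes _ = below-u x<y
      ... | no _ = ℕ.<⇒≱ y<z (out-max u≢v _)
      noncrossing′ : Noncrossing Edge (pos ∘ ρ)
      noncrossing′ (inj₁ x~z) (inj₁ y~w) = noncrossing x~z y~w
      noncrossing′ {c = inj₂ z} (inj₂ _) _ _ y<z z<w = extreme z y<z z<w
      noncrossing′ {b = inj₂ y} (inj₁ _) (inj₂ _) x<y y<z _ = extreme y x<y y<z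

  parallel-layout : BiLayout H
  parallel-layout with u Fin.≟ v | inLabel A Fin.≟ outLabel A
  ... | yes u≡v | _ = retraction-layout (collapse (subst (λ t → inj₁ u ≈ inj₁ t) u≡v ε))
  -- The single label vertex of `A` is glued to both `u` and `v` and thereby identifies them.
  ... | no _ | yes i≡o = retraction-layout (collapse (EqC.return in-in ◅◅
          subst (λ t → inj₂ t ≈ inj₁ v) (sym i≡o) (EqC.symmetric _ (EqC.return out-out))))
  ... | no u≢v | no i≢o = retraction-layout (keep u≢v i≢o)

-- Series composition

bounded : ∀ {n} (f : Fin n → ℕ) → ∃ λ M → ∀ i → f i < M
bounded {zero} f = 0 , λ ()
bounded {suc n} f = let (M , f<M) = bounded (f ∘ suc) in
  suc (f zero) ⊔ M , λ { zero → ℕ.m≤m⊔n _ M ; (suc i) → ℕ.≤-trans (f<M i) (ℕ.m≤n⊔m _ M) }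

module _ {F F′ H : BilabelledGraph} (L : BiLayout F) (L′ : BiLayout F′) (S : IsSeries F F′ H) where
  open BiLayout L
  open BiLayout L′ using () renaming
    (pos to pos′; injective to injective′; noncrossing to noncrossing′; in-min to in-min′; out-max to out-max′)
  open IsSeries S
  private
    u w : V F
    u = inLabel F
    w = outLabel F
    w′ v : V F′
    w′ = inLabel F′
    v = outLabel F′
    M : ℕ
    M = proj₁ (bounded pos)
    <M : ∀ x → pos x < M
    <M = proj₂ (bounded pos)

    -- The vertices of F′ other than its in-label are placed after those of F.
    κ : V F ⊎ V F′ → ℕ
    κ (inj₁ x) = pos x
    κ (inj₂ y) with y Fin.≟ w′
    ... | yes _ = pos w
    ... | no _ = M + pos′ y

    κ-glued : κ (inj₂ w′) ≡ pos w
    κ-glued with w′ Fin.≟ w′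
    ... | yes _ = refl
    ... | no w′≢w′ = contradiction refl w′≢w′

    <M+ : ∀ x {n} → pos x < M + n
    <M+ x = ℕ.<-≤-trans (<M x) (ℕ.m≤m+n M _)

    _≈_ : Rel (V F ⊎ V F′) 0ℓ
    _≈_ = EqClosure (SeriesId F F′)

    glued : ∀ x y → pos x ≡ κ (inj₂ y) → inj₁ x ≈ inj₂ y
    glued x y e with y Fin.≟ w′
    ... | yes refl = subst (λ t → inj₁ t ≈ inj₂ w′) (sym (injective e)) (EqC.return out-in)
    ... | no _ = contradiction e (ℕ.<⇒≢ (<M+ x))

    separates : ∀ x y → κ x ≡ κ y → x ≈ y
    separates (inj₁ x) (inj₁ y) e = subst (λ t → inj₁ x ≈ inj₁ t) (injective e) ε
    separates (inj₁ x) (inj₂ y) e = glued x y e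
    separates (inj₂ x) (inj₁ y) e = EqC.symmetric _ (glued y x (sym e))
    separates (inj₂ x) (inj₂ y) e with x Fin.≟ w′ | y Fin.≟ w′
    ... | yes refl | yes refl = ε
    ... | yes _ | no _ = contradiction e (ℕ.<⇒≢ (<M+ w))
    ... | no _ | yes _ = contradiction (sym e) (ℕ.<⇒≢ (<M+ w))
    ... | no _ | no _ = subst (λ t → inj₂ x ≈ inj₂ t) (injective′ (ℕ.+-cancelˡ-≡ M _ _ e)) ε

    reflects-< : ∀ x y → κ (inj₂ x) < κ (inj₂ y) → pos′ x < pos′ y
    reflects-< x y x<y with x Fin.≟ w′ | y Fin.≟ w′
    ... | yes _ | yes _ = contradiction x<y (ℕ.<-irrefl refl)
    ... | yes refl | no y≢w′ = ℕ.≤∧≢⇒< (in-min′ y) (y≢w′ ∘ sym ∘ injective′)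
    ... | no _ | yes _ = contradiction (<M+ w) (ℕ.<-asym x<y)
    ... | no _ | no _ = ℕ.+-cancelˡ-< M _ _ x<y

    extreme : ∀ {x z} → pos x < pos w → ¬ pos w < pos z
    extreme {x} {z} x<w w<z with u Fin.≟ w
    ... | yes u≡w = ℕ.<⇒≱ (subst (λ t → pos x < pos t) (sym u≡w) x<w) (in-min x)
    ... | no u≢w = ℕ.<⇒≱ w<z (out-max u≢w z)

    not-between : ∀ {x z} y → pos x < κ (inj₂ y) → ¬ κ (inj₂ y) < pos z
    not-between y x<y y<z with y Fin.≟ w′
    ... | yes _ = extreme x<y y<z
    ... | no _ = ℕ.<-asym y<z (<M+ _)

    -- When an edge of `F` crosses one of `F′`, an end of the latter lies strictly between two
    -- vertices of `F`. But a vertex of `F′` sits after all of `F`, or else at `w`, which is first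
    -- or last in `F`.
    κ-noncrossing : Noncrossing (Pointwise (Adj (graph F)) (Adj (graph F′))) κ
    κ-noncrossing (inj₁ x~z) (inj₁ y~w) x<y y<z z<w = noncrossing x~z y~w x<y y<z z<w
    κ-noncrossing {b = inj₂ y} (inj₁ _) (inj₂ _) x<y y<z _ = not-between y x<y y<z
    κ-noncrossing {c = inj₂ z} (inj₂ _) (inj₁ _) _ y<z z<w = not-between z y<z z<w
    κ-noncrossing {inj₂ x} {inj₂ y} {inj₂ z} {inj₂ w} (inj₂ x~z) (inj₂ y~w) x<y y<z z<w =
      noncrossing′ x~z y~w (reflects-< x y x<y) (reflects-< y z y<z) (reflects-< z w z<w)

    in-least : ∀ z → pos u ≤ κ z
    in-least (inj₁ x) = in-min x
    in-least (inj₂ y) with y Fin.≟ w′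
    ... | yes _ = in-min w
    ... | no _ = ℕ.<⇒≤ (<M+ u)

    out-greatest : w′ ≢ v → ∀ z → κ z ≤ κ (inj₂ v)
    out-greatest w′≢v z with v Fin.≟ w′
    ... | yes v≡w′ = contradiction (sym v≡w′) w′≢v
    out-greatest w′≢v (inj₁ x) | no _ = ℕ.<⇒≤ (<M+ x)
    out-greatest w′≢v (inj₂ y) | no _ with y Fin.≟ w′
    ... | yes _ = ℕ.<⇒≤ (<M+ w)
    ... | no _ = ℕ.+-monoʳ-≤ M (out-max′ w′≢v y)

  -- The excluded case is `u ≢ w` with `w′ ≡ v`: there the out-label of `H` is the glued vertex, and
  -- the other vertices of `F′` would be placed after it.
  series-layout : u ≡ w ⊎ w′ ≢ v → BiLayout H
  series-layout cond = record { layout = layout-H ; in-min = in-min-H ; out-max = out-max-H cond }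
    where
    descended = gluing-layout isGluing κ (λ { out-in → sym κ-glued }) separates κ-noncrossing
    layout-H = proj₁ descended
    pos-q = proj₂ descended
    open Layout layout-H renaming (pos to pos-H; injective to injective-H) using ()
    pos-in : pos-H (inLabel H) ≡ pos u
    pos-in = trans (cong pos-H in-eq) (pos-q _)
    pos-out : pos-H (outLabel H) ≡ κ (inj₂ v)
    pos-out = trans (cong pos-H out-eq) (pos-q _)
    lift : ∀ x → ∃ λ z → pos-H x ≡ κ z
    lift x = let (z , e) = IsGluing.surjective isGluing x in z , trans (cong pos-H (sym e)) (pos-q z)
    in-min-H : ∀ x → pos-H (inLabel H) ≤ pos-H x
    in-min-H x = let (z , e) = lift x in subst₂ _≤_ (sym pos-in) (sym e) (in-least z)
    max : w′ ≢ v → ∀ x → pos-H x ≤ pos-H (outLabel H)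
    max w′≢v x = let (z , e) = lift x in subst₂ _≤_ (sym e) (sym pos-out) (out-greatest w′≢v z)
    out-max-H : u ≡ w ⊎ w′ ≢ v → inLabel H ≢ outLabel H → ∀ x → pos-H x ≤ pos-H (outLabel H)
    out-max-H (inj₂ w′≢v) _ = max w′≢v
    out-max-H (inj₁ u≡w) in≢out with w′ Fin.≟ v
    ... | no w′≢v = max w′≢v
    -- With `u ≡ w` and `w′ ≡ v`, both labels of `H` are the glued vertex.
    ... | yes w′≡v = contradiction (injective-H (trans pos-in (trans (cong pos u≡w)
            (trans (sym κ-glued) (trans (cong (κ ∘ inj₂) w′≡v) (sym pos-out)))))) in≢out

swap-series : ∀ {F F′ H} → IsSeries F F′ H → IsSeries (swap F′) (swap F) (swap H)
swap-series {F} {F′} {H} S = record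
  { proj = proj ∘ Sum.swap
  ; isGluing = record
    { surjective = λ h → let (x , e) = surjective h in Sum.swap x , trans (cong proj (Sum.swap-involutive x)) e
    ; identifies = λ x y → mk⇔
        (λ e → subst₂ (EqClosure _) (Sum.swap-involutive x) (Sum.swap-involutive y)
                 (turn (Equivalence.to (identifies _ _) e)))
        (Equivalence.from (identifies _ _) ∘ turn′)
    ; adjacency = λ a b → mk⇔
        (λ a~b → let (x , y , ex , ey , x~y) = Equivalence.to (adjacency a b) a~b in
           Sum.swap x , Sum.swap y , trans (cong proj (Sum.swap-involutive x)) ex
                      , trans (cong proj (Sum.swap-involutive y)) ey , swap-edge x~y)
        (λ (x , y , ex , ey , x~y) → Equivalence.from (adjacency a b)
           (Sum.swap x , Sum.swap y , ex , ey , swap-edge x~y))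
    }
  ; in-eq = out-eq
  ; out-eq = in-eq
  }
  where
  open IsSeries S
  open IsGluing isGluing
  turn : ∀ {x y} → EqClosure (SeriesId F F′) x y →
         EqClosure (SeriesId (swap F′) (swap F)) (Sum.swap x) (Sum.swap y)
  turn = EqC.gfold (EqC.isEquivalence _) Sum.swap λ { out-in → EqC.symmetric _ (EqC.return out-in) }
  turn′ : ∀ {x y} → EqClosure (SeriesId (swap F′) (swap F)) x y →
          EqClosure (SeriesId F F′) (Sum.swap x) (Sum.swap y)
  turn′ = EqC.gfold (EqC.isEquivalence _) Sum.swap λ { out-in → EqC.symmetric _ (EqC.return out-in) }
  swap-edge : ∀ {A B : Set} {R : Rel A 0ℓ} {S : Rel B 0ℓ} {x y} →
              Pointwise R S x y → Pointwise S R (Sum.swap x) (Sum.swap y)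
  swap-edge (inj₁ x~y) = inj₂ x~y
  swap-edge (inj₂ x~y) = inj₁ x~y

L₁-layout : ∀ {F} → L₁ F → BiLayout F
L₁-layout (atomic A) = atomic-layout A
L₁-layout (parallel F A P) = parallel-layout (L₁-layout F) A P
L₁-layout (permute F) = swap-layout (L₁-layout F)
L₁-layout (series {F} {F′} l l′ S) with inLabel F Fin.≟ outLabel F | inLabel F′ Fin.≟ outLabel F′
... | yes u≡w | _ = series-layout (L₁-layout l) (L₁-layout l′) S (inj₁ u≡w)
... | no _ | no w′≢v = series-layout (L₁-layout l) (L₁-layout l′) S (inj₂ w′≢v)
-- In the reversed composition the factor with coinciding labels comes in front, so its other
-- vertices are placed between the labels' vertex and the rest.
... | no _ | yes w′≡v = swap-layout (series-layout (swap-layout (L₁-layout l′)) (swap-layout (L₁-layout l))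
        (swap-series S) (inj₁ (sym w′≡v)))

≅-layout : ∀ {G H} → G ≅ H → Layout G → Layout H
≅-layout {G} {H} iso L = record
  { pos = pos ∘ from
  ; injective = λ e → trans (sym (inverseˡ refl)) (trans (cong to (injective e)) (inverseˡ refl))
  ; noncrossing = λ a~c b~d → noncrossing (pull a~c) (pull b~d)
  }
  where
  open _≅_ iso
  open Inverse bijection using (inverseˡ)
  open Layout L
  pull : ∀ {x y} → Adj H x y → Adj G (from x) (from y)
  pull x~y = Equivalence.from (adjacency _ _) (subst₂ (Adj H) (sym (inverseˡ refl)) (sym (inverseˡ refl)) x~y)

L₁⇒outerplanar : ∀ {G} → UnderliesL₁ G → Outerplanar G
L₁⇒outerplanar (F , l , F≅G) = layout⇒outerplanar (≅-layout F≅G (BiLayout.layout (L₁-layout l)))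

-- Components and Menger's theorem

module _ {n : ℕ} {P : Fin n → Set} (P? : ∀ x → Dec (P x)) where

  comprehension : Subset n
  comprehension = tabulate (does ∘ P?)

  ∈-comprehension⁺ : ∀ {x} → P x → x ∈ comprehension
  ∈-comprehension⁺ {x} px = lookup⇒[]= x _ (trans (lookup∘tabulate _ x) (dec-true (P? x) px))

  ∈-comprehension⁻ : ∀ {x} → x ∈ comprehension → P x
  ∈-comprehension⁻ {x} x∈ with P? x | trans (sym (lookup∘tabulate (does ∘ P?) x)) ([]=⇒lookup x∈)
  ... | yes px | _ = px
  ... | no _ | ()

exit : ∀ {n} {R : Rel (Fin n) 0ℓ} {A : Subset n} {x y} → Star R x y → x ∈ A → y ∉ A →
       ∃₂ λ a b → a ∈ A × b ∉ A × R a b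
exit ε x∈A x∉A = contradiction x∈A x∉A
exit {A = A} (_◅_ {i = x} {j = z} x~z w) x∈A y∉A with z ∈? A
... | yes z∈A = exit w z∈A y∉A
... | no z∉A = x , z , x∈A , z∉A , x~z

module _ (G : Graph) where
  open Graph G using (_~_; _~?_; ~-sym)

  private
    n : ℕ
    n = order G

  singleton-connected : ∀ x → Connected G ⁅ x ⁆
  singleton-connected x y∈ z∈ with x∈⁅y⁆⇒x≡y x y∈ | x∈⁅y⁆⇒x≡y x z∈
  ... | refl | refl = ε

  Touching : Subset n → Subset n → Set
  Touching A B = ∃₂ λ a b → a ∈ A × b ∈ B × a ~ b

  touching? : ∀ A B → Dec (Touching A B)
  touching? A B = Fin.any? λ a → Fin.any? λ b → (a ∈? A) ×-dec (b ∈? B) ×-dec (a ~? b)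

  record Reach (T X : Subset n) : Set where
    field
      set     : Subset n
      ⊆T      : set ⊆ T
      ⊇X      : X ⊆ set
      closed  : ∀ {y z} → y ∈ set → z ∈ T → y ~ z → z ∈ set
      reached : ∀ {y} → y ∈ set → ∃ λ x → x ∈ X × Star (Within G set) x y

  reach : ∀ {T X} → X ⊆ T → Reach T X
  reach {T} X⊆T = grow (⊃-wellFounded _) X⊆T
    where
    grow : ∀ {X} → Acc _⊃_ X → X ⊆ T → Reach T X
    grow {X} (acc rec) X⊆T with Fin.any? (λ z →
      (z ∈? T) ×-dec ¬? (z ∈? X) ×-dec Fin.any? (λ x → (x ∈? X) ×-dec (x ~? z)))
    ... | no stuck = record
      { set = X ; ⊆T = X⊆T ; ⊇X = id
      ; closed = λ {y} {z} y∈X z∈T y~z → decidable-stable (z ∈? X) λ z∉X →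
          stuck (z , z∈T , z∉X , y , y∈X , y~z)
      ; reached = λ y∈X → _ , y∈X , ε }
    ... | yes (z , z∈T , z∉X , x , x∈X , x~z) = record
      { set = set ; ⊆T = ⊆T ; ⊇X = ⊇X ∘ X⊆ ; closed = closed
      ; reached = λ y∈ → restart (reached y∈) }
      where
      X⊆ : X ⊆ X ∪ ⁅ z ⁆
      X⊆ = x∈p∪q⁺ ∘ inj₁
      z∈ : z ∈ X ∪ ⁅ z ⁆
      z∈ = x∈p∪q⁺ (inj₂ (x∈⁅x⁆ z))
      X′⊆T : X ∪ ⁅ z ⁆ ⊆ T
      X′⊆T y∈ = [ X⊆T , (λ y∈z → subst (_∈ T) (sym (x∈⁅y⁆⇒x≡y z y∈z)) z∈T) ]′ (x∈p∪q⁻ X ⁅ z ⁆ y∈)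
      open Reach (grow (rec (X⊆ , z , z∈ , z∉X)) X′⊆T)
      restart : ∀ {y} → (∃ λ x → x ∈ X ∪ ⁅ z ⁆ × Star (Within G set) x y) →
                ∃ λ x → x ∈ X × Star (Within G set) x y
      restart (x′ , x′∈ , w) with x∈p∪q⁻ X ⁅ z ⁆ x′∈
      ... | inj₁ x′∈X = x′ , x′∈X , w
      ... | inj₂ x′∈z with x∈⁅y⁆⇒x≡y z x′∈z
      ...   | refl = x , x∈X , (⊇X (X⊆ x∈X) , ⊇X z∈ , x~z) ◅ w

  record Component (T : Subset n) (x : Fin n) : Set where
    field
      set       : Subset n
      root      : x ∈ set
      ⊆T        : set ⊆ T
      closed    : ∀ {y z} → y ∈ set → z ∈ T → y ~ z → z ∈ set
      connected : Connected G set

    absorb : ∀ {B b} → Connected G B → B ⊆ T → b ∈ B → b ∈ set → B ⊆ set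
    absorb cB B⊆T b∈B b∈set {z} z∈B = decidable-stable (z ∈? set) λ z∉set →
      let (_ , _ , y∈ , y′∉ , _ , y′∈B , y~y′) = exit (cB b∈B z∈B) b∈set z∉set
      in y′∉ (closed y∈ (B⊆T y′∈B) y~y′)

  component : ∀ {T x} → x ∈ T → Component T x
  component {T} {x} x∈T = record
    { set = set ; root = ⊇X (x∈⁅x⁆ x) ; ⊆T = ⊆T ; closed = closed
    ; connected = λ y∈ z∈ → within-reverse {G} (from-root y∈) ◅◅ from-root z∈ }
    where
    ⁅x⁆⊆T : ⁅ x ⁆ ⊆ T
    ⁅x⁆⊆T y∈ = subst (_∈ T) (sym (x∈⁅y⁆⇒x≡y x y∈)) x∈T
    open Reach (reach ⁅x⁆⊆T)
    from-root : ∀ {y} → y ∈ set → Star (Within G set) x y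
    from-root y∈ with reached y∈
    ... | z , z∈ , w with x∈⁅y⁆⇒x≡y x z∈
    ... | refl = w

  -- Two disjoint paths

  record Path (U : Subset n) (v : Fin n) : Set where
    field
      set       : Subset n
      connected : Connected G set
      start     : ∃ λ x → x ∈ U × x ∈ set
      end       : v ∈ set

  -- The inner vertices of a path from `U` to `v`. Like `Path`, it is only a connected set, since
  -- branch sets of a minor ask for no more.
  record Link (U : Subset n) (v : Fin n) (B : Subset n) : Set where
    field
      connected : Connected G B
      disjoint  : Disjoint U B
      v∉        : v ∉ B
      from-U    : Touching U B
      to-v      : ∃ λ b → b ∈ B × b ~ v

  record Links (U : Subset n) (v : Fin n) : Set where
    field
      {left right} : Subset n
      linkˡ        : Link U v left
      linkʳ        : Link U v right
      disjoint     : Disjoint left right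

  private
    -- After `a` has been added to `U`, both links found may start at `a` alone. A detour provides a
    -- second start from `U` proper: it keeps clear of `a` and of the links, collected in `B`, until
    -- it is next to `v` or `B`.
    record Detour (U : Subset n) (v a : Fin n) (B : Subset n) : Set where
      field
        {set}     : Subset n
        connected : Connected G set
        disjoint  : Disjoint U set
        v∉        : v ∉ set
        a∉        : a ∉ set
        avoids    : Disjoint B set
        from-U    : Touching U set
        hits      : ∃₂ λ q z → q ∈ set × q ~ z × (z ≡ v ⊎ z ∈ B)

    -- Let `Y` be what is reachable from `U` outside `B`, `a` and `v`. The path `p` starts in `Y`,
    -- ends outside and avoids `a`, so it leaves `Y` into `v` or `B`. The component, off `U`, of the
    -- vertex before that exit is the detour; it touches `U` since that vertex was reached from `U`
    -- within `Y`.
    detour : ∀ {U v a B} → v ∉ U → (∀ {x} → x ∈ U → ¬ x ~ v) → a ∉ U →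
             Disjoint U B → ¬ Touching U B →
             (p : Path U v) → a ∉ Path.set p → Detour U v a B
    detour {U} {v} {a} {B} v∉U U≁v a∉U U∩B U≁B p a∉p =
      let (y , z , y∈Y , z∉Y , (_ , z∈p , y~z)) = leave-Y in enclose y∈Y y~z (target z∉Y z∈p y∈Y y~z)
      where
      open Path p renaming (set to P) using (start; end)
      T? : ∀ x → Dec (x ∉ B × x ≢ a × x ≢ v)
      T? x = ¬? (x ∈? B) ×-dec ¬? (x Fin.≟ a) ×-dec ¬? (x Fin.≟ v)
      T : Subset n
      T = comprehension T?
      U⊆T : U ⊆ T
      U⊆T x∈U = ∈-comprehension⁺ T? (U∩B x∈U , (λ { refl → a∉U x∈U }) , λ { refl → v∉U x∈U })
      open Reach (reach U⊆T) renaming (set to Y)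
      leave-Y : ∃₂ λ y z → y ∈ Y × z ∉ Y × Within G P y z
      leave-Y = let (x , x∈U , x∈P) = start in
        exit (Path.connected p x∈P end) (⊇X x∈U) λ v∈Y → proj₂ (proj₂ (∈-comprehension⁻ T? (⊆T v∈Y))) refl
      target : ∀ {y z} → z ∉ Y → z ∈ P → y ∈ Y → y ~ z → z ≡ v ⊎ z ∈ B
      target {y} {z} z∉Y z∈P y∈Y y~z with z Fin.≟ v | z ∈? B
      ... | yes z≡v | _ = inj₁ z≡v
      ... | no _ | yes z∈B = inj₂ z∈B
      ... | no z≢v | no z∉B =
        contradiction (closed y∈Y (∈-comprehension⁺ T? (z∉B , (λ { refl → a∉p z∈P }) , z≢v)) y~z) z∉Y
      W? : ∀ x → Dec (x ∈ T × x ∉ U)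
      W? x = (x ∈? T) ×-dec ¬? (x ∈? U)
      enclose : ∀ {y z} → y ∈ Y → y ~ z → z ≡ v ⊎ z ∈ B → Detour U v a B
      enclose {y} {z} y∈Y y~z hit = record
        { connected = C.connected
        ; disjoint = λ x∈U x∈C → proj₂ (W x∈C) x∈U
        ; v∉ = λ v∈C → proj₂ (proj₂ (in-T v∈C)) refl
        ; a∉ = λ a∈C → proj₁ (proj₂ (in-T a∈C)) refl
        ; avoids = λ x∈B x∈C → proj₁ (in-T x∈C) x∈B
        ; from-U = from-U
        ; hits = y , z , C.root , y~z , hit
        }
        where
        y∉U : y ∉ U
        y∉U y∈U = [ (λ { refl → U≁v y∈U y~z }) , (λ z∈B → U≁B (_ , _ , y∈U , z∈B , y~z)) ]′ hit
        module C = Component (component (∈-comprehension⁺ W? (⊆T y∈Y , y∉U)))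
        W : ∀ {x} → x ∈ C.set → x ∈ T × x ∉ U
        W = ∈-comprehension⁻ W? ∘ C.⊆T
        in-T : ∀ {x} → x ∈ C.set → x ∉ B × x ≢ a × x ≢ v
        in-T = ∈-comprehension⁻ T? ∘ proj₁ ∘ W
        from-U : Touching U C.set
        from-U with reached y∈Y
        ... | x , x∈U , w with exit (within-reverse {G} w) C.root (λ x∈C → proj₂ (W x∈C) x∈U)
        ... | c , d , c∈C , d∉C , _ , d∈Y , c~d with d ∈? U
        ... | yes d∈U = d , c , d∈U , c∈C , ~-sym c~d
        ... | no d∉U = contradiction (C.closed c∈C (∈-comprehension⁺ W? (⊆T d∈Y , d∉U)) c~d) d∉C

  private
    -- The hypothesis of Menger's theorem: no single vertex outside `U` and other than `v` separates
    -- them.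
    Unavoidable : Subset n → Fin n → Set
    Unavoidable U v = ∀ w → w ∉ U → w ≢ v → ∃ λ (p : Path U v) → w ∉ Path.set p

    -- A link that starts in `U ∪ ⁅ a ⁆` but does not touch `U` starts at `a`; absorbing `a` makes
    -- it start in `U`.
    link-grow : ∀ {U v a B} → a ∉ U → a ≢ v → Touching U ⁅ a ⁆ →
                Link (U ∪ ⁅ a ⁆) v B → ¬ Touching U B → Link U v (B ∪ ⁅ a ⁆)
    link-grow {U} {v} {a} {B} a∉U a≢v U~a l U≁B = record
      { connected = connected-∪ {G} connected (singleton-connected a) B~a
      ; disjoint = disjoint-∪ʳ (disjoint ∘ x∈p∪q⁺ ∘ inj₁) λ x∈U x∈a → a∉U (subst (_∈ U) (x∈⁅y⁆⇒x≡y a x∈a) x∈U)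
      ; v∉ = λ v∈ → [ v∉ , (λ v∈a → a≢v (sym (x∈⁅y⁆⇒x≡y a v∈a))) ]′ (x∈p∪q⁻ B ⁅ a ⁆ v∈)
      ; from-U = let (x , a′ , x∈ , a′∈ , x~a) = U~a in x , a′ , x∈ , x∈p∪q⁺ (inj₂ a′∈) , x~a
      ; to-v = let (b , b∈B , b~v) = to-v in b , x∈p∪q⁺ (inj₁ b∈B) , b~v
      }
      where
      open Link l
      B~a : Touching B ⁅ a ⁆
      B~a with from-U
      ... | x , b , x∈ , b∈B , x~b with x∈p∪q⁻ U ⁅ a ⁆ x∈
      ... | inj₁ x∈U = contradiction (x , b , x∈U , b∈B , x~b) U≁B
      ... | inj₂ x∈a = b , x , b∈B , x∈a , ~-sym x~b

    link-shrink : ∀ {U v a B} → Link (U ∪ ⁅ a ⁆) v B → Touching U B → Link U v B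
    link-shrink l U~B = record
      { connected = connected ; disjoint = disjoint ∘ x∈p∪q⁺ ∘ inj₁ ; v∉ = v∉ ; from-U = U~B ; to-v = to-v }
      where open Link l

    detour-link : ∀ {U v a B} (d : Detour U v a B) → ∃ (λ q → q ∈ Detour.set d × q ~ v) →
                  Link U v (Detour.set d)
    detour-link d to-v = record
      { connected = connected ; disjoint = disjoint ; v∉ = v∉ ; from-U = from-U ; to-v = to-v }
      where open Detour d

    detour-join : ∀ {U v a B C} (d : Detour U v a B) → C ⊆ B → Touching (Detour.set d) C →
                  Link (U ∪ ⁅ a ⁆) v C → Link U v (Detour.set d ∪ C)
    detour-join {C = C} d C⊆B d~C l = record
      { connected = connected-∪ {G} connected (Link.connected l) d~C
      ; disjoint = disjoint-∪ʳ disjoint (Link.disjoint l ∘ x∈p∪q⁺ ∘ inj₁)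
      ; v∉ = λ v∈ → [ v∉ , Link.v∉ l ]′ (x∈p∪q⁻ set C v∈)
      ; from-U = let (x , y , x∈ , y∈ , x~y) = from-U in x , y , x∈ , x∈p∪q⁺ (inj₁ y∈) , x~y
      ; to-v = let (b , b∈ , b~v) = Link.to-v l in b , x∈p∪q⁺ (inj₂ b∈) , b~v
      }
      where open Detour d

    ∉⇒disjoint : ∀ {a} {B : Subset n} → a ∉ B → Disjoint B ⁅ a ⁆
    ∉⇒disjoint {a} a∉B x∈B x∈a = a∉B (subst (_∈ _) (x∈⁅y⁆⇒x≡y a x∈a) x∈B)

    -- Both links start at `a`. The link that the detour runs into takes the detour as its new
    -- beginning, and the other one absorbs `a`. If the detour is next to `v`, it is a link by
    -- itself.
    detour-links : ∀ {U v a} → a ∉ U → a ≢ v → Touching U ⁅ a ⁆ → (l : Links (U ∪ ⁅ a ⁆) v) →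
                   ¬ Touching U (Links.left l) → ¬ Touching U (Links.right l) →
                   Detour U v a (Links.left l ∪ Links.right l) → Links U v
    detour-links {U} {v} {a} a∉U a≢v U~a l U≁L U≁R d = finish hits
      where
      open Links l
      open Detour d renaming (set to Q) using (a∉; avoids; hits)
      a∉L : a ∉ left
      a∉L = Link.disjoint linkˡ (x∈p∪q⁺ (inj₂ (x∈⁅x⁆ a)))
      a∉R : a ∉ right
      a∉R = Link.disjoint linkʳ (x∈p∪q⁺ (inj₂ (x∈⁅x⁆ a)))
      Q∩L : Disjoint Q left
      Q∩L = disjoint-sym (avoids ∘ x∈p∪q⁺ ∘ inj₁)
      Q∩R : Disjoint Q right
      Q∩R = disjoint-sym (avoids ∘ x∈p∪q⁺ ∘ inj₂)
      finish : (∃₂ λ q z → q ∈ Q × q ~ z × (z ≡ v ⊎ z ∈ left ∪ right)) → Links U v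
      finish (q , z , q∈Q , q~z , inj₁ refl) = record
        { linkˡ = detour-link d (q , q∈Q , q~z) ; linkʳ = link-grow a∉U a≢v U~a linkʳ U≁R
        ; disjoint = disjoint-∪ʳ Q∩R (∉⇒disjoint a∉) }
      finish (q , z , q∈Q , q~z , inj₂ z∈) with x∈p∪q⁻ left right z∈
      ... | inj₁ z∈L = record
        { linkˡ = detour-join d (x∈p∪q⁺ ∘ inj₁) (q , z , q∈Q , z∈L , q~z) linkˡ
        ; linkʳ = link-grow a∉U a≢v U~a linkʳ U≁R
        ; disjoint = disjoint-∪ˡ (disjoint-∪ʳ Q∩R (∉⇒disjoint a∉)) (disjoint-∪ʳ disjoint (∉⇒disjoint a∉L)) }
      ... | inj₂ z∈R = record
        { linkˡ = detour-join d (x∈p∪q⁺ ∘ inj₂) (q , z , q∈Q , z∈R , q~z) linkʳ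
        ; linkʳ = link-grow a∉U a≢v U~a linkˡ U≁L
        ; disjoint = disjoint-∪ˡ (disjoint-∪ʳ Q∩L (∉⇒disjoint a∉))
                                 (disjoint-∪ʳ (disjoint-sym disjoint) (∉⇒disjoint a∉R)) }

    -- A link that touches `U` can stay as it is, so `a` is free for the other one; only if neither
    -- touches `U` do they compete for `a` and a detour is called for.
    reroute : ∀ {U v a} → v ∉ U → (∀ {x} → x ∈ U → ¬ x ~ v) → a ∉ U → a ≢ v → Touching U ⁅ a ⁆ →
              (p : Path U v) → a ∉ Path.set p → Links (U ∪ ⁅ a ⁆) v → Links U v
    reroute {U} {v} {a} v∉U U≁v a∉U a≢v U~a p a∉p l with touching? U (Links.left l) | touching? U (Links.right l)
    ... | yes U~L | yes U~R = record
      { linkˡ = link-shrink linkˡ U~L ; linkʳ = link-shrink linkʳ U~R ; disjoint = disjoint }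
      where open Links l
    ... | yes U~L | no U≁R = record
      { linkˡ = link-shrink linkˡ U~L ; linkʳ = link-grow a∉U a≢v U~a linkʳ U≁R
      ; disjoint = disjoint-∪ʳ disjoint (∉⇒disjoint a∉L) }
      where
      open Links l
      a∉L = Link.disjoint linkˡ (x∈p∪q⁺ (inj₂ (x∈⁅x⁆ a)))
    ... | no U≁L | yes U~R = record
      { linkˡ = link-grow a∉U a≢v U~a linkˡ U≁L ; linkʳ = link-shrink linkʳ U~R
      ; disjoint = disjoint-∪ˡ disjoint (disjoint-sym (∉⇒disjoint a∉R)) }
      where
      open Links l
      a∉R = Link.disjoint linkʳ (x∈p∪q⁺ (inj₂ (x∈⁅x⁆ a)))
    ... | no U≁L | no U≁R = detour-links a∉U a≢v U~a l U≁L U≁R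
        (detour v∉U U≁v a∉U
          (disjoint-∪ʳ (Link.disjoint linkˡ ∘ x∈p∪q⁺ ∘ inj₁) (Link.disjoint linkʳ ∘ x∈p∪q⁺ ∘ inj₁))
          (λ { (x , y , x∈U , y∈ , x~y) →
            [ (λ y∈L → U≁L (x , y , x∈U , y∈L , x~y)) , (λ y∈R → U≁R (x , y , x∈U , y∈R , x~y)) ]′
            (x∈p∪q⁻ left right y∈) })
          p a∉p)
      where open Links l

    path-grow : ∀ {U v a} → Path U v → Path (U ∪ ⁅ a ⁆) v
    path-grow p = record
      { connected = connected
      ; start = let (x , x∈U , x∈) = start in x , x∈p∪q⁺ (inj₁ x∈U) , x∈
      ; end = end }
      where open Path p

  -- Menger's theorem for two paths, by growing U one neighbour at a time.
  menger : ∀ {U v} → Acc _⊃_ U → v ∉ U → (∀ {x} → x ∈ U → ¬ x ~ v) → Path U v → Unavoidable U v → Links U v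
  menger {U} {v} (acc rec) v∉U U≁v p bypass
    with exit (Path.connected p (proj₂ (proj₂ (Path.start p))) (Path.end p)) (proj₁ (proj₂ (Path.start p))) v∉U
  ... | y , a , y∈U , a∉U , _ , _ , y~a = step (a ~? v)
    where
    a≢v : a ≢ v
    a≢v refl = U≁v y∈U y~a
    U~a : Touching U ⁅ a ⁆
    U~a = y , a , y∈U , x∈⁅x⁆ a , y~a
    around : ∃ λ (p : Path U v) → a ∉ Path.set p
    around = bypass a a∉U a≢v
    v∉U′ : v ∉ U ∪ ⁅ a ⁆
    v∉U′ v∈ = [ v∉U , (λ v∈a → a≢v (sym (x∈⁅y⁆⇒x≡y a v∈a))) ]′ (x∈p∪q⁻ U ⁅ a ⁆ v∈)
    step : Dec (a ~ v) → Links U v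
    -- Here `a` alone is a link. With no links to run into, `B = ∅`, the detour around `a` ends next
    -- to `v`.
    step (yes a~v) = direct (detour v∉U U≁v a∉U (λ _ → ∉⊥) (λ { (_ , _ , _ , y∈∅ , _) → ∉⊥ y∈∅ })
                                    (proj₁ around) (proj₂ around))
      where
      direct : Detour U v a ∅ → Links U v
      direct d = record
        { linkˡ = detour-link d (via-v hits)
        ; linkʳ = record
          { connected = singleton-connected a
          ; disjoint = ∉⇒disjoint a∉U
          ; v∉ = λ v∈a → a≢v (sym (x∈⁅y⁆⇒x≡y a v∈a))
          ; from-U = U~a
          ; to-v = a , x∈⁅x⁆ a , a~v }
        ; disjoint = ∉⇒disjoint a∉ }
        where
        open Detour d
        via-v : (∃₂ λ q z → q ∈ set × q ~ z × (z ≡ v ⊎ z ∈ ∅)) → ∃ λ q → q ∈ set × q ~ v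
        via-v (q , z , q∈ , q~z , inj₁ refl) = q , q∈ , q~z
        via-v (_ , _ , _ , _ , inj₂ z∈∅) = contradiction z∈∅ ∉⊥
    step (no a≁v) = reroute v∉U U≁v a∉U a≢v U~a (proj₁ around) (proj₂ around)
      (menger (rec (x∈p∪q⁺ ∘ inj₁ , a , x∈p∪q⁺ (inj₂ (x∈⁅x⁆ a)) , a∉U)) v∉U′
        (λ x∈ → [ U≁v , (λ x∈a → subst (λ t → ¬ t ~ v) (sym (x∈⁅y⁆⇒x≡y a x∈a)) a≁v) ]′ (x∈p∪q⁻ U ⁅ a ⁆ x∈))
        (path-grow p)
        (λ w w∉U′ w≢v → map₂₁ (bypass w (w∉U′ ∘ x∈p∪q⁺ ∘ inj₁) w≢v)))
      where
      map₂₁ : ∀ {w} → (∃ λ (p : Path U v) → w ∉ Path.set p) → ∃ λ (p : Path (U ∪ ⁅ a ⁆) v) → w ∉ Path.set p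
      map₂₁ (p , w∉p) = path-grow p , w∉p

-- Realising vertex subsets of an ambient graph in L₁

record Enumeration {n} (S : Subset n) : Set where
  field
    {size}    : ℕ
    enum      : Fin size → Fin n
    injective : ∀ {i j} → enum i ≡ enum j → i ≡ j
    enum∈     : ∀ i → enum i ∈ S
    onto      : ∀ {x} → x ∈ S → ∃ λ i → enum i ≡ x

enumerate : ∀ {n} (S : Subset n) → Enumeration S
enumerate [] = record { size = 0 ; enum = λ () ; injective = λ { {()} } ; enum∈ = λ () ; onto = λ () }
enumerate (outside ∷ S) = record
  { enum = suc ∘ enum
  ; injective = injective ∘ Fin.suc-injective
  ; enum∈ = there ∘ enum∈
  ; onto = λ { (there x∈) → map₂ (cong suc) (onto x∈) } }
  where open Enumeration (enumerate S)
enumerate (inside ∷ S) = record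
  { enum = λ { zero → zero ; (suc i) → suc (enum i) }
  ; injective = λ { {zero} {zero} _ → refl ; {suc _} {suc _} e → cong suc (injective (Fin.suc-injective e)) }
  ; enum∈ = λ { zero → here ; (suc i) → there (enum∈ i) }
  ; onto = λ { here → zero , refl ; (there x∈) → let (i , e) = onto x∈ in suc i , cong suc e } }
  where open Enumeration (enumerate S)

-- F is a copy of the graph (S , E) with freshly numbered vertices; only embed refers to the ambient graph.
record Piece {n} (E : Rel (Fin n) 0ℓ) (S : Subset n) (u v : Fin n) : Set₁ where
  field
    F         : BilabelledGraph
    embed     : V F → Fin n
    injective : ∀ {x y} → embed x ≡ embed y → x ≡ y
    embed∈    : ∀ x → embed x ∈ S
    onto      : ∀ {z} → z ∈ S → ∃ λ x → embed x ≡ z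
    adjacency : ∀ x y → Adj (graph F) x y ⇔ E (embed x) (embed y)
    in-label  : embed (inLabel F) ≡ u
    out-label : embed (outLabel F) ≡ v

  edge⁺ : ∀ {x y} → E (embed x) (embed y) → Adj (graph F) x y
  edge⁺ = Equivalence.from (adjacency _ _)

  edge⁻ : ∀ {x y} → Adj (graph F) x y → E (embed x) (embed y)
  edge⁻ = Equivalence.to (adjacency _ _)

Realised : ∀ {n} → Rel (Fin n) 0ℓ → Subset n → Fin n → Fin n → Set₁
Realised E S u v = Σ (Piece E S u v) λ P → L₁ (Piece.F P)

module _ {n : ℕ} {E : Rel (Fin n) 0ℓ} (E-sym : Symmetric E) (E-dec : Decidable E)
         {S : Subset n} {u v : Fin n} where

  piece : u ∈ S → v ∈ S → Piece E S u v
  piece u∈S v∈S = record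
    { F = record
      { graph = record
        { order = size ; nonEmpty = Fin.nonZeroIndex (proj₁ (onto u∈S))
        ; _~_ = λ x y → E (enum x) (enum y) ; ~-sym = E-sym ; _~?_ = λ x y → E-dec (enum x) (enum y) }
      ; inLabel = proj₁ (onto u∈S) ; outLabel = proj₁ (onto v∈S) }
    ; embed = enum ; injective = injective ; embed∈ = enum∈ ; onto = onto
    ; adjacency = λ x y → ⇔-id _
    ; in-label = proj₂ (onto u∈S) ; out-label = proj₂ (onto v∈S) }
    where open Enumeration (enumerate S)

  realised-atomic : u ∈ S → v ∈ S → (∀ {z} → z ∈ S → z ≡ u ⊎ z ≡ v) → Realised E S u v
  realised-atomic u∈S v∈S S⊆uv = P , atomic λ x →
    Sum.map (λ x≡u → injective (trans x≡u (sym in-label))) (λ x≡v → injective (trans x≡v (sym out-label)))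
      (S⊆uv (embed∈ x))
    where
    P = piece u∈S v∈S
    open Piece P

module _ {n : ℕ} {F F′ H : Graph} {R : Rel (Vertex F ⊎ Vertex F′) 0ℓ}
         (f : Vertex H → Fin n) (f-injective : ∀ {x y} → f x ≡ f y → x ≡ y)
         (g : Vertex F ⊎ Vertex F′ → Fin n) (lift : ∀ x → ∃ λ h → f h ≡ g x) where

  gluing : (∀ h → ∃ λ x → g x ≡ f h) →
           (∀ {x y} → R x y → g x ≡ g y) → (∀ x y → g x ≡ g y → EqClosure R x y) →
           (∀ {h k} → Adj H h k → ∃₂ λ x y → g x ≡ f h × g y ≡ f k × Pointwise (Adj F) (Adj F′) x y) →
           (∀ {h k x y} → g x ≡ f h → g y ≡ f k → Pointwise (Adj F) (Adj F′) x y → Adj H h k) →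
           IsGluing F F′ R H (proj₁ ∘ lift)
  gluing onto respects separates edge⁻ edge⁺ = record
    { surjective = λ h → let (x , e) = onto h in x , f-injective (trans (proj₂ (lift x)) e)
    ; identifies = λ x y → mk⇔
        (λ e → separates x y (trans (sym (proj₂ (lift x))) (trans (cong f e) (proj₂ (lift y)))))
        (λ x≈y → f-injective (trans (proj₂ (lift x))
          (trans (EqC.gfold isEquivalence g respects x≈y) (sym (proj₂ (lift y))))))
    ; adjacency = λ a b → mk⇔
        (λ a~b → let (x , y , ex , ey , x~y) = edge⁻ a~b in
          x , y , f-injective (trans (proj₂ (lift x)) ex) , f-injective (trans (proj₂ (lift y)) ey) , x~y)
        (λ { (x , y , refl , refl , x~y) → edge⁺ (sym (proj₂ (lift x))) (sym (proj₂ (lift y))) x~y })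
    }

-- The union of two subgraphs. Each has its own edge relation because one factor may be taken in G
-- and another in G minus an edge.
record Cover {n} (E₁ : Rel (Fin n) 0ℓ) (S₁ : Subset n) (E₂ : Rel (Fin n) 0ℓ) (S₂ : Subset n)
             (E : Rel (Fin n) 0ℓ) (S : Subset n) : Set where
  field
    ⊆₁     : S₁ ⊆ S
    ⊆₂     : S₂ ⊆ S
    cover  : ∀ {x} → x ∈ S → x ∈ S₁ ⊎ x ∈ S₂
    edges₁ : ∀ {x y} → x ∈ S₁ → y ∈ S₁ → E₁ x y → E x y
    edges₂ : ∀ {x y} → x ∈ S₂ → y ∈ S₂ → E₂ x y → E x y
    edges  : ∀ {x y} → x ∈ S → y ∈ S → E x y → (x ∈ S₁ × y ∈ S₁ × E₁ x y) ⊎ (x ∈ S₂ × y ∈ S₂ × E₂ x y)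

module _ {n : ℕ} {E₁ E₂ E : Rel (Fin n) 0ℓ} {S₁ S₂ S : Subset n} (C : Cover E₁ S₁ E₂ S₂ E S)
         {a b c d u v : Fin n} (P₁ : Piece E₁ S₁ a b) (P₂ : Piece E₂ S₂ c d) (P : Piece E S u v) where
  open Cover C
  private
    module P₁ = Piece P₁
    module P₂ = Piece P₂
    module P = Piece P

    g : V P₁.F ⊎ V P₂.F → Fin n
    g = [ P₁.embed , P₂.embed ]′

    g∈ : ∀ x → g x ∈ S
    g∈ = [ ⊆₁ ∘ P₁.embed∈ , ⊆₂ ∘ P₂.embed∈ ]

  cover-proj : ∀ x → ∃ λ h → P.embed h ≡ g x
  cover-proj x = P.onto (g∈ x)

  -- Both embeddings are injective, so identifications arise only between a vertex of one piece and
  -- a vertex of the other with the same image.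
  cover-gluing : ∀ {R} → (∀ {x y} → R x y → g x ≡ g y) →
                 (∀ x y → P₁.embed x ≡ P₂.embed y → EqClosure R (inj₁ x) (inj₂ y)) →
                 IsGluing (graph P₁.F) (graph P₂.F) R (graph P.F) (proj₁ ∘ cover-proj)
  cover-gluing {R} respects cross = gluing P.embed P.injective g cover-proj onto respects separates edge⁻ edge⁺
    where
    onto : ∀ h → ∃ λ x → g x ≡ P.embed h
    onto h with cover (P.embed∈ h)
    ... | inj₁ h∈ = let (x , e) = P₁.onto h∈ in inj₁ x , e
    ... | inj₂ h∈ = let (x , e) = P₂.onto h∈ in inj₂ x , e
    separates : ∀ x y → g x ≡ g y → EqClosure R x y
    separates (inj₁ x) (inj₁ y) e with P₁.injective e
    ... | refl = ε
    separates (inj₁ x) (inj₂ y) e = cross x y e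
    separates (inj₂ x) (inj₁ y) e = EqC.symmetric _ (cross y x (sym e))
    separates (inj₂ x) (inj₂ y) e with P₂.injective e
    ... | refl = ε
    edge⁻ : ∀ {h k} → Adj (graph P.F) h k →
            ∃₂ λ x y → g x ≡ P.embed h × g y ≡ P.embed k × Pointwise (Adj (graph P₁.F)) (Adj (graph P₂.F)) x y
    edge⁻ {h} {k} h~k with edges (P.embed∈ h) (P.embed∈ k) (P.edge⁻ h~k)
    ... | inj₁ (h∈ , k∈ , e) = let (x , ex) = P₁.onto h∈ ; (y , ey) = P₁.onto k∈ in
      inj₁ x , inj₁ y , ex , ey , inj₁ (P₁.edge⁺ (subst₂ E₁ (sym ex) (sym ey) e))
    ... | inj₂ (h∈ , k∈ , e) = let (x , ex) = P₂.onto h∈ ; (y , ey) = P₂.onto k∈ in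
      inj₂ x , inj₂ y , ex , ey , inj₂ (P₂.edge⁺ (subst₂ E₂ (sym ex) (sym ey) e))
    edge⁺ : ∀ {h k x y} → g x ≡ P.embed h → g y ≡ P.embed k →
            Pointwise (Adj (graph P₁.F)) (Adj (graph P₂.F)) x y → Adj (graph P.F) h k
    edge⁺ ex ey (inj₁ x~y) = P.edge⁺ (subst₂ E ex ey (edges₁ (P₁.embed∈ _) (P₁.embed∈ _) (P₁.edge⁻ x~y)))
    edge⁺ ex ey (inj₂ x~y) = P.edge⁺ (subst₂ E ex ey (edges₂ (P₂.embed∈ _) (P₂.embed∈ _) (P₂.edge⁻ x~y)))

module _ {n : ℕ} {E₁ E₂ E : Rel (Fin n) 0ℓ} {S₁ S₂ S : Subset n} (C : Cover E₁ S₁ E₂ S₂ E S)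
         (E-sym : Symmetric E) (E-dec : Decidable E) where
  open Cover C

  realised-series : ∀ {u w v} → (∀ {z} → z ∈ S₁ → z ∈ S₂ → z ≡ w) →
                    Realised E₁ S₁ u w → Realised E₂ S₂ w v → Realised E S u v
  realised-series {u} {w} {v} meet (P₁ , l₁) (P₂ , l₂) = P , series l₁ l₂ record
    { proj = proj₁ ∘ q
    ; isGluing = cover-gluing C P₁ P₂ P respects cross
    ; in-eq = P.injective (trans P.in-label (sym (trans (proj₂ (q (inj₁ _))) P₁.in-label)))
    ; out-eq = P.injective (trans P.out-label (sym (trans (proj₂ (q (inj₂ _))) P₂.out-label)))
    }
    where
    module P₁ = Piece P₁
    module P₂ = Piece P₂
    P : Piece E S u v
    P = piece E-sym E-dec (⊆₁ (subst (_∈ S₁) P₁.in-label (P₁.embed∈ _)))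
                          (⊆₂ (subst (_∈ S₂) P₂.out-label (P₂.embed∈ _)))
    module P = Piece P
    q = cover-proj C P₁ P₂ P
    respects : ∀ {x y} → SeriesId P₁.F P₂.F x y → [ P₁.embed , P₂.embed ]′ x ≡ [ P₁.embed , P₂.embed ]′ y
    respects out-in = trans P₁.out-label (sym P₂.in-label)
    cross : ∀ x y → P₁.embed x ≡ P₂.embed y → EqClosure (SeriesId P₁.F P₂.F) (inj₁ x) (inj₂ y)
    cross x y e with meet (P₁.embed∈ x) (subst (_∈ S₂) (sym e) (P₂.embed∈ y))
    ... | x≡w with P₁.injective (trans x≡w (sym P₁.out-label))
                 | P₂.injective (trans (sym e) (trans x≡w (sym P₂.in-label)))
    ... | refl | refl = EqC.return out-in

  realised-parallel : ∀ {u v} → (∀ {z} → z ∈ S₂ → z ≡ u ⊎ z ≡ v) → u ∈ S₂ → v ∈ S₂ →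
                      Symmetric E₂ → Decidable E₂ → Realised E₁ S₁ u v → Realised E S u v
  realised-parallel {u} {v} S₂⊆uv u∈S₂ v∈S₂ E₂-sym E₂-dec (P₁ , l₁) = P , parallel l₁ A-atomic record
    { proj = proj₁ ∘ q
    ; isGluing = cover-gluing C P₁ P₂ P respects cross
    ; in-eq = P.injective (trans P.in-label (sym (trans (proj₂ (q (inj₁ _))) P₁.in-label)))
    ; out-eq = P.injective (trans P.out-label (sym (trans (proj₂ (q (inj₁ _))) P₁.out-label)))
    }
    where
    module P₁ = Piece P₁
    P₂ : Piece E₂ S₂ u v
    P₂ = piece E₂-sym E₂-dec u∈S₂ v∈S₂
    module P₂ = Piece P₂
    P : Piece E S u v
    P = piece E-sym E-dec (⊆₂ u∈S₂) (⊆₂ v∈S₂)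
    module P = Piece P
    q = cover-proj C P₁ P₂ P
    labels : ∀ y → y ≡ inLabel P₂.F ⊎ y ≡ outLabel P₂.F
    labels y = Sum.map (λ y≡u → P₂.injective (trans y≡u (sym P₂.in-label)))
                       (λ y≡v → P₂.injective (trans y≡v (sym P₂.out-label))) (S₂⊆uv (P₂.embed∈ y))
    A-atomic : Atomic P₂.F
    A-atomic = labels
    respects : ∀ {x y} → ParallelId P₁.F P₂.F x y → [ P₁.embed , P₂.embed ]′ x ≡ [ P₁.embed , P₂.embed ]′ y
    respects in-in = trans P₁.in-label (sym P₂.in-label)
    respects out-out = trans P₁.out-label (sym P₂.out-label)
    cross : ∀ x y → P₁.embed x ≡ P₂.embed y → EqClosure (ParallelId P₁.F P₂.F) (inj₁ x) (inj₂ y)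
    cross x y e with labels y
    ... | inj₁ refl with P₁.injective (trans e (trans P₂.in-label (sym P₁.in-label)))
    ...   | refl = EqC.return in-in
    cross x y e | inj₂ refl with P₁.injective (trans e (trans P₂.out-label (sym P₁.out-label)))
    ...   | refl = EqC.return out-out

-- Its labels coincide and it has no loop, so parallel composition with it merges the two labels and
-- does nothing else.
point : BilabelledGraph
point = record
  { graph = record { order = 1 ; nonEmpty = _ ; _~_ = λ _ _ → ⊥ ; ~-sym = id ; _~?_ = λ _ _ → no id }
  ; inLabel = zero ; outLabel = zero }

-- The piece is first extended by a new in-label 0 hanging on a; contracting the new in-label and the
-- out-label u to one vertex then closes the piece up, with a new edge from a to u.
module _ {n : ℕ} {E E′ : Rel (Fin n) 0ℓ} (E-sym : Symmetric E) (E-dec : Decidable E)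
         (E′-sym : Symmetric E′) (E′-dec : Decidable E′) {S : Subset n} {a u : Fin n} where

  private
    -- The condition `E′ a u` makes the pendant edge optional; without it a piece is closed up and
    -- no edge is added.
    Pendant : Rel (Fin (suc n)) 0ℓ
    Pendant zero zero = ⊥
    Pendant zero (suc y) = y ≡ a × E′ a u
    Pendant (suc x) zero = x ≡ a × E′ a u
    Pendant (suc x) (suc y) = E x y

    pendant-sym : Symmetric Pendant
    pendant-sym {zero} {suc _} e = e
    pendant-sym {suc _} {zero} e = e
    pendant-sym {suc _} {suc _} e = E-sym e

    pendant-dec : Decidable Pendant
    pendant-dec zero zero = no id
    pendant-dec zero (suc y) = (y Fin.≟ a) ×-dec E′-dec a u
    pendant-dec (suc x) zero = (x Fin.≟ a) ×-dec E′-dec a u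
    pendant-dec (suc x) (suc y) = E-dec x y

    shift : Realised E S a u → Realised Pendant (outside ∷ S) (suc a) (suc u)
    shift (P , l) = record
      { F = F ; embed = suc ∘ embed ; injective = injective ∘ Fin.suc-injective
      ; embed∈ = there ∘ embed∈
      ; onto = λ { (there z∈) → map₂ (cong suc) (onto z∈) }
      ; adjacency = adjacency ; in-label = cong suc in-label ; out-label = cong suc out-label } , l
      where open Piece P

    new : Subset (suc n)
    new = inside ∷ ⁅ a ⁆

    extend : a ∈ S → Realised E S a u → Realised Pendant (inside ∷ S) zero (suc u)
    extend a∈S R = realised-series cover (λ {x} {y} → pendant-sym {x} {y}) pendant-dec meet
      (realised-atomic (λ {x} {y} → pendant-sym {x} {y}) pendant-dec here (there (x∈⁅x⁆ a)) new⊆)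
      (shift R)
      where
      new⊆ : ∀ {z} → z ∈ new → z ≡ zero ⊎ z ≡ suc a
      new⊆ here = inj₁ refl
      new⊆ (there z∈) = inj₂ (cong suc (x∈⁅y⁆⇒x≡y a z∈))
      meet : ∀ {z} → z ∈ new → z ∈ outside ∷ S → z ≡ suc a
      meet (there z∈) _ = cong suc (x∈⁅y⁆⇒x≡y a z∈)
      cover : Cover Pendant new Pendant (outside ∷ S) Pendant (inside ∷ S)
      cover = record
        { ⊆₁ = λ { here → here ; (there z∈) → there (subst (_∈ S) (sym (x∈⁅y⁆⇒x≡y a z∈)) a∈S) }
        ; ⊆₂ = λ { (there z∈) → there z∈ }
        ; cover = λ { here → inj₁ here ; (there z∈) → inj₂ (there z∈) }
        ; edges₁ = λ _ _ → id
        ; edges₂ = λ _ _ → id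
        ; edges = λ { here here () ; here (there _) (refl , e) → inj₁ (here , there (x∈⁅x⁆ a) , refl , e)
                    ; (there _) here (refl , e) → inj₁ (there (x∈⁅x⁆ a) , here , refl , e)
                    ; (there x∈) (there y∈) e → inj₂ (there x∈ , there y∈ , e) }
        }

    contract : Fin (suc n) → Fin n
    contract zero = u
    contract (suc x) = x

  realised-close : a ∈ S → u ∈ S → (∀ {x y} → E x y → E′ x y) →
                   (∀ {x y} → x ∈ S → y ∈ S → E′ x y → E x y ⊎ (x ≡ a × y ≡ u) ⊎ (x ≡ u × y ≡ a)) →
                   Realised E S a u → Realised E′ S u u
  realised-close a∈S u∈S E⊆E′ E′⊆ R = close (extend a∈S R)
    where
    close : Realised Pendant (inside ∷ S) zero (suc u) → Realised E′ S u u
    close (Q , l) = P , parallel l (λ { zero → inj₁ refl }) record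
      { proj = proj₁ ∘ lift
      ; isGluing = gluing P.embed P.injective g lift onto respects separates edge⁻ edge⁺
      ; in-eq = P.injective (trans P.in-label (sym (trans (proj₂ (lift (inj₁ _))) (cong contract Q.in-label))))
      ; out-eq = P.injective (trans P.out-label (sym (trans (proj₂ (lift (inj₁ _))) (cong contract Q.out-label))))
      }
      where
      module Q = Piece Q
      P : Piece E′ S u u
      P = piece E′-sym E′-dec u∈S u∈S
      module P = Piece P
      _≈_ : Rel (V Q.F ⊎ V point) 0ℓ
      _≈_ = EqClosure (ParallelId Q.F point)
      g : V Q.F ⊎ V point → Fin n
      g = [ contract ∘ Q.embed , (λ _ → u) ]′
      contract∈ : ∀ {x} → x ∈ inside ∷ S → contract x ∈ S
      contract∈ here = u∈S
      contract∈ (there x∈) = x∈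
      lift : ∀ x → ∃ λ h → P.embed h ≡ g x
      lift (inj₁ x) = P.onto (contract∈ (Q.embed∈ x))
      lift (inj₂ _) = P.onto u∈S
      over : ∀ {z} → z ∈ S → ∃ λ x → Q.embed x ≡ suc z
      over z∈ = Q.onto (there z∈)
      onto : ∀ h → ∃ λ x → g x ≡ P.embed h
      onto h = let (x , e) = over (P.embed∈ h) in inj₁ x , cong contract e
      respects : ∀ {x y} → ParallelId Q.F point x y → g x ≡ g y
      respects in-in = cong contract Q.in-label
      respects out-out = cong contract Q.out-label
      -- Under `contract` only `u` has two preimages, `zero` and `suc u`. They are the two labels,
      -- which `point` identifies.
      at-u : ∀ x → g x ≡ u → x ≈ inj₂ zero
      at-u (inj₂ zero) _ = ε
      at-u (inj₁ x) e with Q.embed x in eq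
      ... | zero with Q.injective (trans eq (sym Q.in-label))
      ...   | refl = EqC.return in-in
      at-u (inj₁ x) refl | suc _ with Q.injective (trans eq (sym Q.out-label))
      ...   | refl = EqC.return out-out
      away : ∀ x y → g x ≢ u → g x ≡ g y → x ≈ y
      away (inj₂ _) _ x≢u _ = contradiction refl x≢u
      away _ (inj₂ _) x≢u e = contradiction e x≢u
      away (inj₁ x) (inj₁ y) x≢u e with Q.embed x in ex | Q.embed y in ey
      ... | zero | _ = contradiction refl x≢u
      ... | suc _ | zero = contradiction e x≢u
      ... | suc _ | suc _ with Q.injective (trans ex (trans (cong suc e) (sym ey)))
      ...   | refl = ε
      separates : ∀ x y → g x ≡ g y → x ≈ y
      separates x y e with g x Fin.≟ u
      ... | yes x≡u = at-u x x≡u ◅◅ EqC.symmetric _ (at-u y (trans (sym e) x≡u))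
      ... | no x≢u = away x y x≢u e
      Edge : Rel (V Q.F ⊎ V point) 0ℓ
      Edge = Pointwise (Adj (graph Q.F)) (Adj (graph point))
      over-edge : ∀ {x y} → Pendant x y → x ∈ inside ∷ S → y ∈ inside ∷ S →
                  ∃₂ λ s t → g s ≡ contract x × g t ≡ contract y × Edge s t
      over-edge e x∈ y∈ = let (s , es) = Q.onto x∈ ; (t , et) = Q.onto y∈ in
        inj₁ s , inj₁ t , cong contract es , cong contract et ,
        inj₁ (Q.edge⁺ (subst₂ Pendant (sym es) (sym et) e))
      split-edge : ∀ {x y} → x ∈ S → y ∈ S → E′ x y → E x y ⊎ (x ≡ a × y ≡ u) ⊎ (x ≡ u × y ≡ a) →
                   ∃₂ λ s t → g s ≡ x × g t ≡ y × Edge s t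
      split-edge x∈ y∈ _ (inj₁ e) = over-edge e (there x∈) (there y∈)
      -- The restored edge between `a` and `u` is the image of the pendant edge, as `contract` sends
      -- `zero` to `u`.
      split-edge x∈ _ e (inj₂ (inj₁ (refl , refl))) = over-edge {suc a} {zero} (refl , e) (there x∈) here
      split-edge _ y∈ e (inj₂ (inj₂ (refl , refl))) = over-edge {zero} {suc a} (refl , E′-sym e) here (there y∈)
      edge⁻ : ∀ {h k} → Adj (graph P.F) h k → ∃₂ λ x y → g x ≡ P.embed h × g y ≡ P.embed k × Edge x y
      edge⁻ {h} {k} h~k = split-edge (P.embed∈ h) (P.embed∈ k) (P.edge⁻ h~k)
                            (E′⊆ (P.embed∈ h) (P.embed∈ k) (P.edge⁻ h~k))
      contract-edge : ∀ {x y} → Pendant x y → E′ (contract x) (contract y)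
      contract-edge {zero} {suc _} (refl , e) = E′-sym e
      contract-edge {suc _} {zero} (refl , e) = e
      contract-edge {suc _} {suc _} e = E⊆E′ e
      edge⁺ : ∀ {h k x y} → g x ≡ P.embed h → g y ≡ P.embed k → Edge x y → Adj (graph P.F) h k
      edge⁺ ex ey (inj₁ x~y) = P.edge⁺ (subst₂ E′ ex ey (contract-edge {Q.embed _} {Q.embed _} (Q.edge⁻ x~y)))

-- Series decompositions of outerplanar graphs

search : ∀ {n} {A B : Fin n → Set} → (∀ i → A i ⊎ B i) → (∃ A) ⊎ (∀ i → B i)
search {zero} f = inj₂ λ ()
search {suc n} f with f zero | search (f ∘ suc)
... | inj₁ a | _ = inj₁ (zero , a)
... | inj₂ _ | inj₁ (i , a) = inj₁ (suc i , a)
... | inj₂ b | inj₂ bs = inj₂ λ { zero → b ; (suc i) → bs i }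

disjoint-family : ∀ {m n} {A : Fin m → Subset n} → (∀ {i j} → i Fin.< j → Disjoint (A i) (A j)) →
                  ∀ {i j x} → x ∈ A i → x ∈ A j → i ≡ j
disjoint-family disjoint {i} {j} x∈i x∈j with Fin.<-cmp i j
... | tri< i<j _ _ = contradiction x∈j (disjoint i<j x∈i)
... | tri≈ _ i≡j _ = i≡j
... | tri> _ _ j<i = contradiction x∈i (disjoint j<i x∈j)

≢⇒disjoint : ∀ {n} {x y : Fin n} → x ≢ y → Disjoint ⁅ x ⁆ ⁅ y ⁆
≢⇒disjoint {x = x} {y} x≢y z∈x z∈y = x≢y (trans (sym (x∈⁅y⁆⇒x≡y x z∈x)) (x∈⁅y⁆⇒x≡y y z∈y))

∉⇒disjointˡ : ∀ {n} {x : Fin n} {A} → x ∉ A → Disjoint ⁅ x ⁆ A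
∉⇒disjointˡ {x = x} {A} x∉A z∈x z∈A = x∉A (subst (_∈ A) (x∈⁅y⁆⇒x≡y x z∈x) z∈A)

module _ (G : Graph) where
  open Graph G using (_~_; _~?_; ~-sym)

  touching-sym : ∀ {A B} → Touching G A B → Touching G B A
  touching-sym (a , b , a∈ , b∈ , a~b) = b , a , b∈ , a∈ , ~-sym a~b

  complete-minor : ∀ {n} {{_ : NonZero n}} (A : Fin n → Subset (order G)) →
                   (∀ i → Nonempty (A i)) → (∀ i → Connected G (A i)) →
                   (∀ {i j} → i Fin.< j → Disjoint (A i) (A j)) →
                   (∀ {i j} → i Fin.< j → Touching G (A i) (A j)) → Minor (complete n) G
  complete-minor A nonempty connected disjoint touching = record
    { branch = A ; nonempty = nonempty ; connected = connected
    ; disjoint = disjoint-family disjoint ; edge = edge }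
    where
    edge : ∀ {i j} → i ≢ j → Touching G (A i) (A j)
    edge {i} {j} i≢j with Fin.<-cmp i j
    ... | tri< i<j _ _ = touching i<j
    ... | tri≈ _ i≡j _ = contradiction i≡j i≢j
    ... | tri> _ _ j<i = touching-sym (touching j<i)

  completeBipartite-minor : ∀ {m n} {{_ : NonZero (m + n)}}
    (A : Fin m → Subset (order G)) (B : Fin n → Subset (order G)) →
    (∀ i → Nonempty (A i)) → (∀ i → Nonempty (B i)) →
    (∀ i → Connected G (A i)) → (∀ i → Connected G (B i)) →
    (∀ {i j} → i Fin.< j → Disjoint (A i) (A j)) → (∀ {i j} → i Fin.< j → Disjoint (B i) (B j)) →
    (∀ i j → Disjoint (A i) (B j)) → (∀ i j → Touching G (A i) (B j)) → Minor (completeBipartite m n) G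
  completeBipartite-minor {m} {n} A B nA nB cA cB dA dB dAB touching = record
    { branch = branch
    ; nonempty = λ a → nonempty (splitAt m a)
    ; connected = λ a → connected (splitAt m a)
    ; disjoint = λ {a} {b} x∈a x∈b → trans (sym (Fin.join-splitAt m n a))
        (trans (cong (Fin.join m n) (disjoint (splitAt m a) (splitAt m b) x∈a x∈b)) (Fin.join-splitAt m n b))
    ; edge = λ {a} {b} → edge a b
    }
    where
    AB : Fin m ⊎ Fin n → Subset (order G)
    AB = [ A , B ]′
    branch : Fin (m + n) → Subset (order G)
    branch = AB ∘ splitAt m
    nonempty : ∀ s → Nonempty (AB s)
    nonempty = [ nA , nB ]
    connected : ∀ s → Connected G (AB s)
    connected (inj₁ i) = cA i
    connected (inj₂ j) = cB j
    disjoint : ∀ s t {x} → x ∈ AB s → x ∈ AB t → s ≡ t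
    disjoint (inj₁ i) (inj₁ j) x∈s x∈t = cong inj₁ (disjoint-family {A = A} dA x∈s x∈t)
    disjoint (inj₁ i) (inj₂ j) x∈s x∈t = contradiction x∈t (dAB i j x∈s)
    disjoint (inj₂ i) (inj₁ j) x∈s x∈t = contradiction x∈s (dAB j i x∈t)
    disjoint (inj₂ i) (inj₂ j) x∈s x∈t = cong inj₂ (disjoint-family {A = B} dB x∈s x∈t)
    edge : ∀ a b → Adj (completeBipartite m n) a b → Touching G (branch a) (branch b)
    edge a b a≁b with splitAt m a | splitAt m b
    ... | inj₁ i | inj₁ j = contradiction refl a≁b
    ... | inj₁ i | inj₂ j = touching i j
    ... | inj₂ i | inj₁ j = touching-sym (touching j i)
    ... | inj₂ i | inj₂ j = contradiction refl a≁b

  -- Separating the ends of a deleted edge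

  Cut : Vertex G → Vertex G → Rel (Vertex G) 0ℓ
  Cut u v x y = x ~ y × ¬ (x ≡ u × y ≡ v) × ¬ (x ≡ v × y ≡ u)

  cut-sym : ∀ {u v} → Symmetric (Cut u v)
  cut-sym (x~y , ≢uv , ≢vu) = ~-sym x~y , (λ (y≡u , x≡v) → ≢vu (x≡v , y≡u)) , λ (y≡v , x≡u) → ≢uv (x≡u , y≡v)

  cut-dec : ∀ {u v} → Decidable (Cut u v)
  cut-dec {u} {v} x y = (x ~? y) ×-dec ¬? ((x Fin.≟ u) ×-dec (y Fin.≟ v)) ×-dec ¬? ((x Fin.≟ v) ×-dec (y Fin.≟ u))

  cut-avoidingˡ : ∀ {u v x y} → x ≢ u → y ≢ u → x ~ y → Cut u v x y
  cut-avoidingˡ x≢u y≢u x~y = x~y , x≢u ∘ proj₁ , y≢u ∘ proj₂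

  cut-avoidingʳ : ∀ {u v x y} → x ≢ v → y ≢ v → x ~ y → Cut u v x y
  cut-avoidingʳ x≢v y≢v x~y = x~y , y≢v ∘ proj₂ , x≢v ∘ proj₁

  -- This is G[S] - uv, kept on all vertices of G with those outside `S` isolated, so that subsets
  -- need no renumbering.
  core : Subset (order G) → Vertex G → Vertex G → Graph
  core S u v = record
    { order = order G ; nonEmpty = Graph.nonEmpty G
    ; _~_ = λ x y → Cut u v x y × x ∈ S × y ∈ S
    ; ~-sym = λ (x~y , x∈S , y∈S) → cut-sym x~y , y∈S , x∈S
    ; _~?_ = λ x y → cut-dec x y ×-dec (x ∈? S) ×-dec (y ∈? S)
    }

  core-connected : ∀ {S u v A} → Connected (core S u v) A → Connected G A
  core-connected cA x∈ y∈ = Star.map (λ (x∈ , y∈ , x~y) → x∈ , y∈ , proj₁ (proj₁ x~y)) (cA x∈ y∈)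

  -- The edge from `U` enters the link at a vertex of `S`, and no edge of the core leaves `S`.
  core-link : ∀ {S a u v U B} → Link (core S a u) U v B → B ⊆ S × Link G U v B
  core-link {S} {B = B} l = B⊆S , record
    { connected = core-connected connected ; disjoint = disjoint ; v∉ = v∉
    ; from-U = let (x , y , x∈ , y∈ , x~y) = from-U in x , y , x∈ , y∈ , proj₁ (proj₁ x~y)
    ; to-v = let (y , y∈ , y~v) = to-v in y , y∈ , proj₁ (proj₁ y~v) }
    where
    open Link l
    B⊆S : B ⊆ S
    B⊆S {x} x∈B = decidable-stable (x ∈? S) λ x∉S →
      let (_ , _ , _ , y∈B , (_ , _ , y∈S)) = from-U
          (_ , _ , _ , z∉S , (_ , _ , (_ , _ , z∈S))) = exit (connected y∈B x∈B) y∈S x∉S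
      in z∉S z∈S

  minus? : ∀ (S : Subset (order G)) w x → Dec (x ∈ S × x ≢ w)
  minus? S w x = (x ∈? S) ×-dec ¬? (x Fin.≟ w)

  minus : Subset (order G) → Vertex G → Subset (order G)
  minus S w = comprehension (minus? S w)

  -- The two obstructions to a pair of disjoint paths in G[S] - uv. For a cut vertex both components
  -- are recorded, as each later becomes part of the outside set for the opposite half.
  data Split (S : Subset (order G)) (u v : Vertex G) : Set where
    apart : (C : Component (core S u v) S u) → v ∉ Component.set C → Split S u v
    cutvertex : ∀ {w} → w ≢ u → w ≢ v → w ∈ S →
                (C : Component (core S u v) (minus S w) u) (D : Component (core S u v) (minus S w) v) →
                v ∉ Component.set C →
                (∃ λ c → c ∈ Component.set C × c ~ w) → (∃ λ d → d ∈ Component.set D × d ~ w) →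
                Split S u v

  split-or-links : ∀ {S u v} → u ∈ S → v ∈ S → u ≢ v → Split S u v ⊎ Links (core S u v) ⁅ u ⁆ v
  split-or-links {S} {u} {v} u∈S v∈S u≢v = decide (component K u∈S)
    where
    K : Graph
    K = core S u v
    Separating Bypassed : Vertex G → Set
    Separating w = w ≢ u × w ≢ v × Σ (Component K (minus S w) u) λ C → v ∉ Component.set C
    Bypassed w = w ∉ ⁅ u ⁆ → w ≢ v → ∃ λ (p : Path K ⁅ u ⁆ v) → w ∉ Path.set p
    path : ∀ {T} (C : Component K T u) → v ∈ Component.set C → Path K ⁅ u ⁆ v
    path C v∈C = record
      { connected = Component.connected C ; start = u , x∈⁅x⁆ u , Component.root C ; end = v∈C }
    classify : ∀ w → Separating w ⊎ Bypassed w
    classify w with w Fin.≟ u | w Fin.≟ v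
    ... | yes refl | _ = inj₂ λ w∉ _ → contradiction (x∈⁅x⁆ u) w∉
    ... | no _ | yes w≡v = inj₂ λ _ w≢v → contradiction w≡v w≢v
    ... | no w≢u | no w≢v = by-component (component K (∈-comprehension⁺ (minus? S w) (u∈S , w≢u ∘ sym)))
      where
      by-component : Component K (minus S w) u → Separating w ⊎ Bypassed w
      by-component C with v ∈? Component.set C
      ... | no v∉C = inj₁ (w≢u , w≢v , C , v∉C)
      ... | yes v∈C = inj₂ λ _ _ →
        path C v∈C , λ w∈C → proj₂ (∈-comprehension⁻ (minus? S w) (Component.⊆T C w∈C)) refl
    -- The walk from `x` to `y` inside `C₀` must leave `C`, and `C` is closed in `S` minus `w`, so
    -- it leaves through `w`.
    separate : ∀ {w x y} → (C₀ : Component K S u) → x ∈ Component.set C₀ → y ∈ Component.set C₀ →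
               (C : Component K (minus S w) x) → y ∉ Component.set C → ∃ λ c → c ∈ Component.set C × Adj K c w
    separate {w} C₀ x∈ y∈ C y∉C
      with exit (Component.connected C₀ x∈ y∈) (Component.root C) y∉C
    ... | c , z , c∈ , z∉ , (_ , _ , c~z@(_ , _ , z∈S)) with z Fin.≟ w
    ...   | yes refl = c , c∈ , c~z
    ...   | no z≢w = contradiction (Component.closed C c∈ (∈-comprehension⁺ (minus? S w) (z∈S , z≢w)) c~z) z∉
    decide : Component K S u → Split S u v ⊎ Links K ⁅ u ⁆ v
    decide C₀ with v ∈? Component.set C₀
    ... | no v∉C₀ = inj₁ (apart C₀ v∉C₀)
    ... | yes v∈C₀ with search classify
    -- Menger's theorem wants `u` and `v` non-adjacent, which holds since their edge is missing from
    -- the core.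
    ...   | inj₂ bypass = inj₂ (menger K (⊃-wellFounded ⁅ u ⁆)
              (λ v∈u → u≢v (sym (x∈⁅y⁆⇒x≡y u v∈u)))
              (λ x∈u x~v → proj₁ (proj₂ (proj₁ x~v)) (x∈⁅y⁆⇒x≡y u x∈u , refl)) (path C₀ v∈C₀) bypass)
    ...   | inj₁ (w , w≢u , w≢v , C , v∉C) =
              inj₁ (build (component K (∈-comprehension⁺ (minus? S w) (v∈S , w≢v ∘ sym))))
      where
      build : Component K (minus S w) v → Split S u v
      build D = cutvertex w≢u w≢v w∈S C D v∉C (forget C~w) (forget D~w)
        where
        u∉D : u ∉ Component.set D
        u∉D u∈D = v∉C (Component.absorb C (Component.connected D) (Component.⊆T D) u∈D (Component.root C)
                        (Component.root D))
        C~w : ∃ λ c → c ∈ Component.set C × Adj K c w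
        C~w = separate C₀ (Component.root C₀) v∈C₀ C v∉C
        D~w : ∃ λ d → d ∈ Component.set D × Adj K d w
        D~w = separate C₀ v∈C₀ (Component.root C₀) D u∉D
        w∈S : w ∈ S
        w∈S = proj₂ (proj₂ (proj₂ (proj₂ C~w)))
        forget : ∀ {A} → (∃ λ c → c ∈ A × Adj K c w) → ∃ λ c → c ∈ A × c ~ w
        forget (c , c∈ , c~w) = c , c∈ , proj₁ (proj₁ c~w)

-- Series decompositions and outside sets

module _ (G : Graph) where
  open Graph G using (_~_; _~?_; ~-sym)

  private
    n : ℕ
    n = order G

  -- A substitute, inside the ambient graph, for attaching a path of length two to the vertices u and v of S.
  record Ext (S : Subset n) (u v : Fin n) : Set where
    field
      set       : Subset n
      connected : Connected G set
      disjoint  : Disjoint set S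
      to-u      : ∃ λ x → x ∈ set × x ~ u
      to-v      : ∃ λ x → x ∈ set × x ~ v

  ext-swap : ∀ {S u v} → Ext S u v → Ext S v u
  ext-swap X = record { connected = connected ; disjoint = disjoint ; to-u = to-v ; to-v = to-u }
    where open Ext X

  -- `D` lies on the far side of the cut vertex `w` and contains `b`. It is adjacent to `w`, and is
  -- linked to `a` through the old outside set or directly by the edge `a ~ b`; this is how an edge
  -- replaces an outside set.
  ext-restrict : ∀ {S S′ D a b w} → Ext S a b ⊎ a ~ b → S′ ⊆ S → Connected G D → b ∈ D →
                 Disjoint D S′ → (∃ λ d → d ∈ D × d ~ w) → Ext S′ a w
  ext-restrict {b = b} (inj₂ a~b) S′⊆S cD b∈D D∩S′ D~w = record
    { connected = cD ; disjoint = D∩S′ ; to-u = b , b∈D , ~-sym a~b ; to-v = D~w }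
  ext-restrict {D = D} {b = b} (inj₁ X) S′⊆S cD b∈D D∩S′ (d , d∈D , d~w) = record
    { set = set ∪ D
    ; connected = connected-∪ {G} connected cD (let (x , x∈ , x~b) = to-v in x , b , x∈ , b∈D , x~b)
    ; disjoint = disjoint-∪ˡ {A = set} {D} (λ x∈X x∈S′ → disjoint x∈X (S′⊆S x∈S′)) D∩S′
    ; to-u = let (x , x∈ , x~a) = to-u in x , x∈p∪q⁺ (inj₁ x∈) , x~a
    ; to-v = d , x∈p∪q⁺ (inj₂ d∈D) , d~w }
    where open Ext X

  -- The two claims need a joint induction: a closed piece may split at a cut vertex into opened
  -- ones, and an opened piece into closed ones if its labels are apart.
  record Realisable (S : Subset n) : Set₁ where
    field
      closed : ∀ {u} → u ∈ S → Realised (Adj G) S u u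
      opened : ∀ {u v} → u ∈ S → v ∈ S → u ≢ v → Ext S u v → Realised (Adj G) S u v

  private
    rest? : ∀ (S C : Subset n) x → Dec (x ∈ S × x ∉ C)
    rest? S C x = (x ∈? S) ×-dec ¬? (x ∈? C)

    rest : Subset n → Subset n → Subset n
    rest S C = comprehension (rest? S C)

    ∈pair⁻ : ∀ {u v z : Fin n} → z ∈ ⁅ u ⁆ ∪ ⁅ v ⁆ → z ≡ u ⊎ z ≡ v
    ∈pair⁻ {u} {v} z∈ = Sum.map (x∈⁅y⁆⇒x≡y u) (x∈⁅y⁆⇒x≡y v) (x∈p∪q⁻ ⁅ u ⁆ ⁅ v ⁆ z∈)

    ∈pairˡ : ∀ {u v : Fin n} → u ∈ ⁅ u ⁆ ∪ ⁅ v ⁆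
    ∈pairˡ = x∈p∪q⁺ (inj₁ (x∈⁅x⁆ _))

    ∈pairʳ : ∀ {u v : Fin n} → v ∈ ⁅ u ⁆ ∪ ⁅ v ⁆
    ∈pairʳ = x∈p∪q⁺ (inj₂ (x∈⁅x⁆ _))

  realised-pair : ∀ {E} → Symmetric E → Decidable E → ∀ {u v} → Realised E (⁅ u ⁆ ∪ ⁅ v ⁆) u v
  realised-pair E-sym E-dec = realised-atomic E-sym E-dec ∈pairˡ ∈pairʳ ∈pair⁻

  -- Three factors in series: `C` closed at `u`, the pair of `u` and `v` with no edge between them,
  -- and the remainder of `S` closed at `v`.
  realise-apart : ∀ {S u v} → u ∈ S → v ∈ S → u ≢ v →
                  (C : Component (core G S u v) S u) → v ∉ Component.set C →
                  (∀ {S′} → S′ ⊂ S → Realisable S′) → Realised (Cut G u v) S u v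
  realise-apart {S} {u} {v} u∈S v∈S u≢v comp v∉C IH =
    realised-series cover₂ (cut-sym G) (cut-dec G) meet₂
      (realised-series cover₁ (cut-sym G) (cut-dec G) meet₁
        (Realisable.closed (IH (⊆T , v , v∈S , v∉C)) root)
        (realised-pair (cut-sym G) (cut-dec G)))
      (Realisable.closed (IH (S₂⊆S , u , u∈S , λ u∈ → ∉C u∈ root)) (∈-comprehension⁺ (rest? S C) (v∈S , v∉C)))
    where
    open Component comp renaming (set to C)
    S₂ : Subset n
    S₂ = rest S C
    S₂⊆S : S₂ ⊆ S
    S₂⊆S = proj₁ ∘ ∈-comprehension⁻ (rest? S C)
    ∉C : ∀ {x} → x ∈ S₂ → x ∉ C
    ∉C = proj₂ ∘ ∈-comprehension⁻ (rest? S C)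
    stays : ∀ {x y} → x ∈ C → y ∈ S → Cut G u v x y → y ∈ C
    stays x∈C y∈S x~y = closed x∈C y∈S (x~y , ⊆T x∈C , y∈S)
    C≢v : ∀ {x} → x ∈ C → x ≢ v
    C≢v x∈C refl = v∉C x∈C
    S₂≢u : ∀ {x} → x ∈ S₂ → x ≢ u
    S₂≢u x∈S₂ refl = ∉C x∈S₂ root
    meet₁ : ∀ {z} → z ∈ C → z ∈ ⁅ u ⁆ ∪ ⁅ v ⁆ → z ≡ u
    meet₁ z∈C z∈ = [ id , (λ z≡v → contradiction z≡v (C≢v z∈C)) ]′ (∈pair⁻ z∈)
    meet₂ : ∀ {z} → z ∈ C ∪ ⁅ v ⁆ → z ∈ S₂ → z ≡ v
    meet₂ z∈ z∈S₂ = [ (λ z∈C → contradiction z∈C (∉C z∈S₂)) , x∈⁅y⁆⇒x≡y v ]′ (x∈p∪q⁻ C ⁅ v ⁆ z∈)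
    in-C : ∀ {x} → x ∈ C → x ∈ C ∪ ⁅ v ⁆
    in-C = x∈p∪q⁺ ∘ inj₁
    at-v : ∀ {x} → x ∈ ⁅ v ⁆ → x ∈ C ∪ ⁅ v ⁆
    at-v = x∈p∪q⁺ ∘ inj₂
    C∪v⊆S : C ∪ ⁅ v ⁆ ⊆ S
    C∪v⊆S z∈ = [ ⊆T , (λ z∈v → subst (_∈ S) (sym (x∈⁅y⁆⇒x≡y v z∈v)) v∈S) ]′ (x∈p∪q⁻ C ⁅ v ⁆ z∈)
    edges₁ : ∀ {x y} → x ∈ C ∪ ⁅ v ⁆ → y ∈ C ∪ ⁅ v ⁆ → Cut G u v x y →
             (x ∈ C × y ∈ C × x ~ y) ⊎ (x ∈ ⁅ u ⁆ ∪ ⁅ v ⁆ × y ∈ ⁅ u ⁆ ∪ ⁅ v ⁆ × Cut G u v x y)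
    edges₁ x∈ y∈ x~y with x∈p∪q⁻ C ⁅ v ⁆ x∈ | x∈p∪q⁻ C ⁅ v ⁆ y∈
    ... | inj₁ x∈C | _ = inj₁ (x∈C , stays x∈C (C∪v⊆S y∈) x~y , proj₁ x~y)
    ... | inj₂ _ | inj₁ y∈C = inj₁ (stays y∈C (C∪v⊆S x∈) (cut-sym G x~y) , y∈C , proj₁ x~y)
    ... | inj₂ x∈v | inj₂ y∈v = inj₂ (x∈p∪q⁺ (inj₂ x∈v) , x∈p∪q⁺ (inj₂ y∈v) , x~y)
    cover₁ : Cover (Adj G) C (Cut G u v) (⁅ u ⁆ ∪ ⁅ v ⁆) (Cut G u v) (C ∪ ⁅ v ⁆)
    cover₁ = record
      { ⊆₁ = in-C
      ; ⊆₂ = λ z∈ → [ (λ { refl → in-C root }) , (λ { refl → at-v (x∈⁅x⁆ v) }) ]′ (∈pair⁻ z∈)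
      ; cover = λ z∈ → Sum.map id (x∈p∪q⁺ ∘ inj₂) (x∈p∪q⁻ C ⁅ v ⁆ z∈)
      ; edges₁ = λ x∈C y∈C → cut-avoidingʳ G (C≢v x∈C) (C≢v y∈C)
      ; edges₂ = λ _ _ → id
      ; edges = edges₁ }
    edges₂ : ∀ {x y} → x ∈ S → y ∈ S → Cut G u v x y →
             (x ∈ C ∪ ⁅ v ⁆ × y ∈ C ∪ ⁅ v ⁆ × Cut G u v x y) ⊎ (x ∈ S₂ × y ∈ S₂ × x ~ y)
    edges₂ {x} {y} x∈S y∈S x~y with x ∈? C | y ∈? C
    ... | yes x∈C | _ = inj₁ (in-C x∈C , in-C (stays x∈C y∈S x~y) , x~y)
    ... | no _ | yes y∈C = inj₁ (in-C (stays y∈C x∈S (cut-sym G x~y)) , in-C y∈C , x~y)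
    ... | no x∉C | no y∉C =
      inj₂ (∈-comprehension⁺ (rest? S C) (x∈S , x∉C) , ∈-comprehension⁺ (rest? S C) (y∈S , y∉C) , proj₁ x~y)
    cover-C : ∀ {x} → x ∈ S → x ∈ C ∪ ⁅ v ⁆ ⊎ x ∈ S₂
    cover-C {x} x∈S with x ∈? C
    ... | yes x∈C = inj₁ (in-C x∈C)
    ... | no x∉C = inj₂ (∈-comprehension⁺ (rest? S C) (x∈S , x∉C))
    cover₂ : Cover (Cut G u v) (C ∪ ⁅ v ⁆) (Adj G) S₂ (Cut G u v) S
    cover₂ = record
      { ⊆₁ = C∪v⊆S ; ⊆₂ = S₂⊆S ; cover = cover-C
      ; edges₁ = λ _ _ → id
      ; edges₂ = λ x∈ y∈ → cut-avoidingˡ G (S₂≢u x∈) (S₂≢u y∈)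
      ; edges = edges₂ }

  -- The factors `C ∪ ⁅ w ⁆` and `S` minus `C` meet in `w` alone. Neither contains both `u` and `v`,
  -- so the deleted edge is absent from both and the induction hypothesis for `Adj G` applies.
  realise-cutvertex : ∀ {S u v w} → u ∈ S → v ∈ S → w ≢ u → w ≢ v → w ∈ S →
    (C : Component (core G S u v) (minus G S w) u) (D : Component (core G S u v) (minus G S w) v) →
    v ∉ Component.set C → (∃ λ c → c ∈ Component.set C × c ~ w) → (∃ λ d → d ∈ Component.set D × d ~ w) →
    Ext S u v ⊎ u ~ v → (∀ {S′} → S′ ⊂ S → Realisable S′) → Realised (Cut G u v) S u v
  realise-cutvertex {S} {u} {v} {w} u∈S v∈S w≢u w≢v w∈S compC compD v∉C C~w D~w ext IH =
    realised-series cover (cut-sym G) (cut-dec G) meet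
      (Realisable.opened (IH (S₁⊆S , v , v∈S , λ v∈ → S₁≢v v∈ refl)) (in-C root) (at-w (x∈⁅x⁆ w)) (w≢u ∘ sym)
        (ext-restrict ext S₁⊆S (core-connected G D.connected) D.root D∩S₁ D~w))
      (Realisable.opened (IH (S₂⊆S , u , u∈S , λ u∈ → ∉C u∈ root)) w∈S₂ (∈-comprehension⁺ (rest? S C) (v∈S , v∉C))
        w≢v (ext-swap (ext-restrict (Sum.map ext-swap ~-sym ext) S₂⊆S (core-connected G connected) root
          (λ x∈C x∈S₂ → ∉C x∈S₂ x∈C) C~w)))
    where
    open Component compC renaming (set to C)
    module D = Component compD
    C⊆S : C ⊆ S
    C⊆S = proj₁ ∘ ∈-comprehension⁻ (minus? G S w) ∘ ⊆T
    C≢w : ∀ {x} → x ∈ C → x ≢ w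
    C≢w = proj₂ ∘ ∈-comprehension⁻ (minus? G S w) ∘ ⊆T
    S₁ S₂ : Subset n
    S₁ = C ∪ ⁅ w ⁆
    S₂ = rest S C
    in-C : ∀ {x} → x ∈ C → x ∈ S₁
    in-C = x∈p∪q⁺ ∘ inj₁
    at-w : ∀ {x} → x ∈ ⁅ w ⁆ → x ∈ S₁
    at-w = x∈p∪q⁺ ∘ inj₂
    S₁⊆S : S₁ ⊆ S
    S₁⊆S z∈ = [ C⊆S , (λ z∈w → subst (_∈ S) (sym (x∈⁅y⁆⇒x≡y w z∈w)) w∈S) ]′ (x∈p∪q⁻ C ⁅ w ⁆ z∈)
    S₁≢v : ∀ {x} → x ∈ S₁ → x ≢ v
    S₁≢v z∈ refl = [ v∉C , (λ v∈w → w≢v (sym (x∈⁅y⁆⇒x≡y w v∈w))) ]′ (x∈p∪q⁻ C ⁅ w ⁆ z∈)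
    S₂⊆S : S₂ ⊆ S
    S₂⊆S = proj₁ ∘ ∈-comprehension⁻ (rest? S C)
    ∉C : ∀ {x} → x ∈ S₂ → x ∉ C
    ∉C = proj₂ ∘ ∈-comprehension⁻ (rest? S C)
    S₂≢u : ∀ {x} → x ∈ S₂ → x ≢ u
    S₂≢u x∈S₂ refl = ∉C x∈S₂ root
    w∈S₂ : w ∈ S₂
    w∈S₂ = ∈-comprehension⁺ (rest? S C) (w∈S , λ w∈C → C≢w w∈C refl)
    stays : ∀ {x y} → x ∈ C → y ∈ S → Cut G u v x y → y ∈ S₁
    stays {y = y} x∈C y∈S x~y with y Fin.≟ w
    ... | yes refl = at-w (x∈⁅x⁆ w)
    ... | no y≢w = in-C (closed x∈C (∈-comprehension⁺ (minus? G S w) (y∈S , y≢w)) (x~y , C⊆S x∈C , y∈S))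
    D∩S₁ : Disjoint D.set S₁
    D∩S₁ {x} x∈D x∈S₁ with x∈p∪q⁻ C ⁅ w ⁆ x∈S₁
    ... | inj₁ x∈C = v∉C (absorb D.connected D.⊆T x∈D x∈C D.root)
    ... | inj₂ x∈w = proj₂ (∈-comprehension⁻ (minus? G S w) (D.⊆T x∈D)) (x∈⁅y⁆⇒x≡y w x∈w)
    meet : ∀ {z} → z ∈ S₁ → z ∈ S₂ → z ≡ w
    meet z∈ z∈S₂ = [ (λ z∈C → contradiction z∈C (∉C z∈S₂)) , x∈⁅y⁆⇒x≡y w ]′ (x∈p∪q⁻ C ⁅ w ⁆ z∈)
    edges : ∀ {x y} → x ∈ S → y ∈ S → Cut G u v x y →
            (x ∈ S₁ × y ∈ S₁ × x ~ y) ⊎ (x ∈ S₂ × y ∈ S₂ × x ~ y)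
    edges {x} {y} x∈S y∈S x~y with x ∈? C | y ∈? C
    ... | yes x∈C | _ = inj₁ (in-C x∈C , stays x∈C y∈S x~y , proj₁ x~y)
    ... | no _ | yes y∈C = inj₁ (stays y∈C x∈S (cut-sym G x~y) , in-C y∈C , proj₁ x~y)
    ... | no x∉C | no y∉C =
      inj₂ (∈-comprehension⁺ (rest? S C) (x∈S , x∉C) , ∈-comprehension⁺ (rest? S C) (y∈S , y∉C) , proj₁ x~y)
    cover-C : ∀ {x} → x ∈ S → x ∈ S₁ ⊎ x ∈ S₂
    cover-C {x} x∈S with x ∈? C
    ... | yes x∈C = inj₁ (in-C x∈C)
    ... | no x∉C = inj₂ (∈-comprehension⁺ (rest? S C) (x∈S , x∉C))
    cover : Cover (Adj G) S₁ (Adj G) S₂ (Cut G u v) S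
    cover = record
      { ⊆₁ = S₁⊆S ; ⊆₂ = S₂⊆S ; cover = cover-C
      ; edges₁ = λ x∈ y∈ → cut-avoidingʳ G (S₁≢v x∈) (S₁≢v y∈)
      ; edges₂ = λ x∈ y∈ → cut-avoidingˡ G (S₂≢u x∈) (S₂≢u y∈)
      ; edges = edges }

  realise-split : ∀ {S u v} → u ∈ S → v ∈ S → u ≢ v → Split G S u v → Ext S u v ⊎ u ~ v →
                  (∀ {S′} → S′ ⊂ S → Realisable S′) → Realised (Cut G u v) S u v
  realise-split u∈S v∈S u≢v (apart C v∉C) _ IH = realise-apart u∈S v∈S u≢v C v∉C IH
  realise-split u∈S v∈S u≢v (cutvertex w≢u w≢v w∈S C D v∉C C~w D~w) ext IH =
    realise-cutvertex u∈S v∈S w≢u w≢v w∈S C D v∉C C~w D~w ext IH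

  -- The atomic factor is the graph induced on `u` and `v`, so nothing changes if they are not
  -- adjacent.
  restore-edge : ∀ {S u v} → u ∈ S → v ∈ S → Realised (Cut G u v) S u v → Realised (Adj G) S u v
  restore-edge {S} {u} {v} u∈S v∈S = realised-parallel cover ~-sym _~?_ ∈pair⁻ ∈pairˡ ∈pairʳ ~-sym _~?_
    where
    edges : ∀ {x y} → x ∈ S → y ∈ S → x ~ y → (x ∈ S × y ∈ S × Cut G u v x y) ⊎
            (x ∈ ⁅ u ⁆ ∪ ⁅ v ⁆ × y ∈ ⁅ u ⁆ ∪ ⁅ v ⁆ × x ~ y)
    edges {x} {y} x∈S y∈S x~y with (x Fin.≟ u) ×-dec (y Fin.≟ v) | (x Fin.≟ v) ×-dec (y Fin.≟ u)
    ... | yes (refl , refl) | _ = inj₂ (∈pairˡ , ∈pairʳ , x~y)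
    ... | no _ | yes (refl , refl) = inj₂ (∈pairʳ , ∈pairˡ , x~y)
    ... | no ≢uv | no ≢vu = inj₁ (x∈S , y∈S , x~y , ≢uv , ≢vu)
    cover : Cover (Cut G u v) S (Adj G) (⁅ u ⁆ ∪ ⁅ v ⁆) (Adj G) S
    cover = record
      { ⊆₁ = id ; ⊆₂ = λ z∈ → [ (λ { refl → u∈S }) , (λ { refl → v∈S }) ]′ (∈pair⁻ z∈)
      ; cover = inj₁ ; edges₁ = λ _ _ → proj₁ ; edges₂ = λ _ _ → id ; edges = edges }

  links⇒K₂,₃ : ∀ {S u v} → u ∈ S → v ∈ S → u ≢ v → Ext S u v → Links (core G S u v) ⁅ u ⁆ v →
               Minor (completeBipartite 2 3) G
  links⇒K₂,₃ {S} {u} {v} u∈S v∈S u≢v X l = completeBipartite-minor G A B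
    (λ { 0F → u , x∈⁅x⁆ u ; 1F → v , x∈⁅x⁆ v })
    (λ { 0F → let (x , x∈ , _) = X.to-u in x , x∈ ; 1F → L-nonempty ; 2F → R-nonempty })
    (λ { 0F → singleton-connected G u ; 1F → singleton-connected G v })
    (λ { 0F → X.connected ; 1F → L.connected ; 2F → R.connected })
    (λ {i} {j} → dA i j) (λ {i} {j} → dB i j) dAB touching
    where
    module X = Ext X
    open Links l
    left⊆S : left ⊆ S
    left⊆S = proj₁ (core-link G linkˡ)
    right⊆S : right ⊆ S
    right⊆S = proj₁ (core-link G linkʳ)
    module L = Link (proj₂ (core-link G linkˡ))
    module R = Link (proj₂ (core-link G linkʳ))
    L-nonempty : Nonempty left
    L-nonempty = let (x , x∈ , _) = L.to-v in x , x∈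
    R-nonempty : Nonempty right
    R-nonempty = let (x , x∈ , _) = R.to-v in x , x∈
    A : Fin 2 → Subset n
    A 0F = ⁅ u ⁆
    A 1F = ⁅ v ⁆
    B : Fin 3 → Subset n
    B 0F = X.set
    B 1F = left
    B 2F = right
    dA : ∀ i j → i Fin.< j → Disjoint (A i) (A j)
    dA 0F 1F _ = ≢⇒disjoint u≢v
    dA 1F 1F (s≤s ())
    dB : ∀ i j → i Fin.< j → Disjoint (B i) (B j)
    dB 0F 1F _ x∈X = X.disjoint x∈X ∘ left⊆S
    dB 0F 2F _ x∈X = X.disjoint x∈X ∘ right⊆S
    dB 1F 2F _ = disjoint
    dB (suc _) 1F (s≤s ())
    dB 2F 2F (s≤s (s≤s ()))
    dAB : ∀ i j → Disjoint (A i) (B j)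
    dAB 0F 0F = ∉⇒disjointˡ λ u∈X → X.disjoint u∈X u∈S
    dAB 0F 1F = L.disjoint
    dAB 0F 2F = R.disjoint
    dAB 1F 0F = ∉⇒disjointˡ λ v∈X → X.disjoint v∈X v∈S
    dAB 1F 1F = ∉⇒disjointˡ L.v∉
    dAB 1F 2F = ∉⇒disjointˡ R.v∉
    hang : ∀ {w C} → (∃ λ x → x ∈ C × x ~ w) → Touching G ⁅ w ⁆ C
    hang {w} (x , x∈ , x~w) = w , x , x∈⁅x⁆ w , x∈ , ~-sym x~w
    touching : ∀ i j → Touching G (A i) (B j)
    touching 0F 0F = hang X.to-u
    touching 0F 1F = L.from-U
    touching 0F 2F = R.from-U
    touching 1F 0F = hang X.to-v
    touching 1F 1F = hang L.to-v
    touching 1F 2F = hang R.to-v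

-- A neighbour whose edge splits

module _ (G : Graph) (¬K₄ : ¬ Minor (complete 4) G) (S : Subset (order G)) {u : Vertex G} (u∈S : u ∈ S) where
  open Graph G using (_~_; _~?_; ~-sym)

  private
    n : ℕ
    n = order G

    SplitNeighbour : Set
    SplitNeighbour = ∃ λ a → a ∈ S × a ≢ u × a ~ u × Split G S a u

    T? : ∀ b x → Dec (x ∈ S × x ≢ u × x ≢ b)
    T? b x = (x ∈? S) ×-dec ¬? (x Fin.≟ u) ×-dec ¬? (x Fin.≟ b)

    T : Fin n → Subset n
    T b = comprehension (T? b)

    link⊆T : ∀ {b B} → B ⊆ S → Link G ⁅ b ⁆ u B → B ⊆ T b
    link⊆T {b} B⊆S l x∈B = ∈-comprehension⁺ (T? b)
      (B⊆S x∈B , (λ { refl → v∉ x∈B }) , λ { refl → disjoint (x∈⁅x⁆ b) x∈B })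
      where open Link l

    -- Two links inside the same component of S − {u, b} yield K₄, with the adjacent vertices u and b as
    -- two of the branch sets.
    linked⇒K₄ : ∀ {b L R K} → b ≢ u → b ~ u → L ⊆ S → R ⊆ S → Link G ⁅ b ⁆ u L → Link G ⁅ b ⁆ u R → Disjoint L R →
                Connected G K → K ⊆ T b → L ⊆ K → R ⊆ K → Minor (complete 4) G
    linked⇒K₄ {b} {L} {R} {K} b≢u b~u L⊆S R⊆S l r L∩R cK K⊆T L⊆K R⊆K =
      build (component G (L⊆T′ (proj₁ (proj₂ (Link.to-v l)))))
      where
      module l = Link l
      module r = Link r
      T′? : ∀ x → Dec (x ∈ T b × x ∉ R)
      T′? x = (x ∈? T b) ×-dec ¬? (x ∈? R)
      T′ : Subset n
      T′ = comprehension T′?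
      L⊆T′ : L ⊆ T′
      L⊆T′ x∈L = ∈-comprehension⁺ T′? (K⊆T (L⊆K x∈L) , L∩R x∈L)
      build : Component G T′ (proj₁ l.to-v) → Minor (complete 4) G
      build M = complete-minor G A nonempty connected (λ {i} {j} → disjoint i j) (λ {i} {j} → touching i j)
        where
        module M = Component M
        L⊆M : L ⊆ M.set
        L⊆M = M.absorb l.connected L⊆T′ (proj₁ (proj₂ l.to-v)) M.root
        in-T : ∀ {x} → x ∈ M.set → x ∈ S × x ≢ u × x ≢ b
        in-T x∈M = ∈-comprehension⁻ (T? b) (proj₁ (∈-comprehension⁻ T′? (M.⊆T x∈M)))
        M∩R : Disjoint M.set R
        M∩R x∈M = proj₂ (∈-comprehension⁻ T′? (M.⊆T x∈M))
        -- A walk in `K` from `L` to `R` has to leave `M`, and a component of `T b` minus `R` can be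
        -- left within `K` only into `R`.
        M~R : Touching G M.set R
        M~R with r.to-v
        ... | y , y∈R , _
          with exit (cK (L⊆K (proj₁ (proj₂ l.to-v))) (R⊆K y∈R)) M.root (λ y∈M → M∩R y∈M y∈R)
        ... | m , z , m∈M , z∉M , _ , z∈K , m~z with z ∈? R
        ... | yes z∈R = m , z , m∈M , z∈R , m~z
        ... | no z∉R = contradiction (M.closed m∈M (∈-comprehension⁺ T′? (K⊆T z∈K , z∉R)) m~z) z∉M
        A : Fin 4 → Subset n
        A 0F = ⁅ u ⁆
        A 1F = ⁅ b ⁆
        A 2F = M.set
        A 3F = R
        nonempty : ∀ i → Nonempty (A i)
        nonempty 0F = u , x∈⁅x⁆ u
        nonempty 1F = b , x∈⁅x⁆ b
        nonempty 2F = _ , M.root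
        nonempty 3F = let (x , x∈ , _) = r.to-v in x , x∈
        connected : ∀ i → Connected G (A i)
        connected 0F = singleton-connected G u
        connected 1F = singleton-connected G b
        connected 2F = M.connected
        connected 3F = r.connected
        disjoint : ∀ i j → i Fin.< j → Disjoint (A i) (A j)
        disjoint 0F 1F _ = ≢⇒disjoint (b≢u ∘ sym)
        disjoint 0F 2F _ = ∉⇒disjointˡ λ u∈M → proj₁ (proj₂ (in-T u∈M)) refl
        disjoint 0F 3F _ = ∉⇒disjointˡ r.v∉
        disjoint 1F 2F _ = ∉⇒disjointˡ λ b∈M → proj₂ (proj₂ (in-T b∈M)) refl
        disjoint 1F 3F _ = r.disjoint
        disjoint 2F 3F _ = M∩R
        disjoint (suc _) 1F (s≤s ())
        disjoint (suc (suc _)) 2F (s≤s (s≤s ()))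
        disjoint 3F 3F (s≤s (s≤s (s≤s ())))
        hang : ∀ {C} → (∃ λ x → x ∈ C × x ~ u) → Touching G ⁅ u ⁆ C
        hang (x , x∈ , x~u) = u , x , x∈⁅x⁆ u , x∈ , ~-sym x~u
        touching : ∀ i j → i Fin.< j → Touching G (A i) (A j)
        touching 0F 1F _ = hang (b , x∈⁅x⁆ b , b~u)
        touching 0F 2F _ = hang (proj₁ l.to-v , M.root , proj₂ (proj₂ l.to-v))
        touching 0F 3F _ = hang r.to-v
        touching 1F 2F _ = let (x , y , x∈ , y∈ , x~y) = l.from-U in x , y , x∈ , L⊆M y∈ , x~y
        touching 1F 3F _ = r.from-U
        touching 2F 3F _ = M~R
        touching (suc _) 1F (s≤s ())
        touching (suc (suc _)) 2F (s≤s (s≤s ()))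
        touching 3F 3F (s≤s (s≤s (s≤s ())))

    -- If the edge at b ∈ C has no split, then one of its two links avoids p, hence lies in a component of
    -- S − {u, b} strictly inside C.
    find : ∀ {C p b} → Acc _⊂_ C → C ⊆ S → u ∉ C →
           (∀ {y z} → y ∈ C → z ∈ S → z ≢ u → z ≢ p → y ~ z → z ∈ C) →
           b ∈ C → b ~ u → SplitNeighbour
    find {C} {p} {b} (acc rec) C⊆S u∉C C-closed b∈C b~u with split-or-links G (C⊆S b∈C) u∈S b≢u
      where
      b≢u : b ≢ u
      b≢u refl = u∉C b∈C
    ... | inj₁ split = b , C⊆S b∈C , (λ { refl → u∉C b∈C }) , b~u , split
    ... | inj₂ links = choose (proj₂ (core-link G linkˡ)) (proj₂ (core-link G linkʳ))
                              (proj₁ (core-link G linkˡ)) (proj₁ (core-link G linkʳ))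
      where
      open Links links renaming (left to L; right to R)
      -- Since `K` avoids `p`, `C-closed` lets no edge lead from `C` to a vertex of `K` outside `C`;
      -- as `K` is connected and contains a neighbour of `b`, it stays in `C`. It misses `b`, hence
      -- is strictly smaller, and `b` becomes the new exceptional vertex.
      descend : ∀ {B x} → Link G ⁅ b ⁆ u B → B ⊆ S → x ∈ B → (K : Component G (T b) x) →
                p ∉ Component.set K → SplitNeighbour
      descend {B} l B⊆S x∈B K p∉K =
        let (y , y∈B , y~u) = to-v
        in find (rec (K⊆C , b , b∈C , λ b∈K → proj₂ (proj₂ (in-T b∈K)) refl)) (proj₁ ∘ in-T)
             (λ u∈K → proj₁ (proj₂ (in-T u∈K)) refl)
             (λ y∈K z∈S z≢u z≢b y~z → K.closed y∈K (∈-comprehension⁺ (T? b) (z∈S , z≢u , z≢b)) y~z)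
             (B⊆K y∈B) y~u
        where
        open Link l
        module K = Component K
        in-T : ∀ {x} → x ∈ K.set → x ∈ S × x ≢ u × x ≢ b
        in-T = ∈-comprehension⁻ (T? b) ∘ K.⊆T
        B⊆K : B ⊆ K.set
        B⊆K = K.absorb connected (link⊆T B⊆S l) x∈B K.root
        enter : ∀ {y z} → y ∈ C → z ∈ K.set → y ~ z → z ∈ C
        enter y∈C z∈K y~z = let (z∈S , z≢u , _) = in-T z∈K in
          C-closed y∈C z∈S z≢u (λ { refl → p∉K z∈K }) y~z
        start : ∃ λ y → y ∈ K.set × y ∈ C
        start with from-U
        ... | x , y , x∈ , y∈B , x~y with x∈⁅y⁆⇒x≡y b x∈
        ... | refl = y , B⊆K y∈B , enter b∈C (B⊆K y∈B) x~y
        K⊆C : K.set ⊆ C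
        K⊆C {z} z∈K = decidable-stable (z ∈? C) λ z∉C →
          let (y , y∈K , y∈C) = start
              (_ , _ , c∈C , d∉C , (_ , d∈K , c~d)) = exit (K.connected y∈K z∈K) y∈C z∉C
          in d∉C (enter c∈C d∈K c~d)
      choose : Link G ⁅ b ⁆ u L → Link G ⁅ b ⁆ u R → L ⊆ S → R ⊆ S → SplitNeighbour
      choose l r L⊆S R⊆S =
        let (x , x∈L , _) = Link.to-v l
            (y , y∈R , _) = Link.to-v r
        in between x∈L y∈R (component G (link⊆T L⊆S l x∈L)) (component G (link⊆T R⊆S r y∈R))
        where
        between : ∀ {x y} → x ∈ L → y ∈ R → Component G (T b) x → Component G (T b) y → SplitNeighbour
        between x∈L y∈R K₁ K₂ with p ∈? Component.set K₁ | p ∈? Component.set K₂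
        ... | no p∉K₁ | _ = descend l L⊆S x∈L K₁ p∉K₁
        ... | yes _ | no p∉K₂ = descend r R⊆S y∈R K₂ p∉K₂
        -- Sharing `p`, the two components coincide, so both links lie in one of them.
        ... | yes p∈K₁ | yes p∈K₂ = contradiction
          (linked⇒K₄ (λ { refl → u∉C b∈C }) b~u L⊆S R⊆S l r disjoint K₁.connected K₁.⊆T
            (K₁.absorb (Link.connected l) (link⊆T L⊆S l) x∈L K₁.root)
            (λ z∈R → K₁.absorb K₂.connected K₂.⊆T p∈K₂ p∈K₁
              (K₂.absorb (Link.connected r) (link⊆T R⊆S r) y∈R K₂.root z∈R)))
          ¬K₄
          where
          module K₁ = Component K₁
          module K₂ = Component K₂

  splitNeighbour : ∀ {b} → b ∈ S → b ≢ u → b ~ u → ∃ λ a → a ∈ S × a ≢ u × a ~ u × Split G S a u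
  -- At the start no vertex besides `u` is exceptional, and `p = u` expresses this.
  splitNeighbour b∈S b≢u b~u = find {p = u} (⊂-wellFounded _)
    (proj₁ ∘ ∈-comprehension⁻ (minus? G S u)) (λ u∈ → proj₂ (∈-comprehension⁻ (minus? G S u) u∈) refl)
    (λ _ z∈S z≢u _ _ → ∈-comprehension⁺ (minus? G S u) (z∈S , z≢u))
    (∈-comprehension⁺ (minus? G S u) (b∈S , b≢u)) b~u

-- The induction on vertex subsets

module _ {G : Graph} (outerplanar : Outerplanar G) where
  open Graph G using (_~_; _~?_; ~-sym)

  private
    n : ℕ
    n = order G

    Smaller : Subset n → Set₁
    Smaller S = ∀ {S′} → S′ ⊂ S → Realisable G S′

  realise-closed : ∀ {S u} → u ∈ S → Smaller S → Realised (Adj G) S u u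
  realise-closed {S} {u} u∈S IH
    with Fin.any? (λ z → minus? G S u z) | Fin.any? (λ b → minus? G S u b ×-dec (b ~? u))
  ... | no only-u | _ = realised-atomic ~-sym _~?_ u∈S u∈S λ {z} z∈S →
          inj₁ (decidable-stable (z Fin.≟ u) λ z≢u → only-u (z , z∈S , z≢u))
  ... | yes _ | yes (b , (b∈S , b≢u) , b~u) =
          let (a , a∈S , a≢u , a~u , split) = splitNeighbour G (proj₁ outerplanar) S u∈S b∈S b≢u b~u
          in realised-close (cut-sym G) (cut-dec G) ~-sym _~?_ a∈S u∈S proj₁ (λ _ _ → cut-or-not)
               (realise-split G a∈S u∈S a≢u split (inj₂ a~u) IH)
    where
    cut-or-not : ∀ {a x y} → x ~ y → Cut G a u x y ⊎ (x ≡ a × y ≡ u) ⊎ (x ≡ u × y ≡ a)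
    cut-or-not {a} {x} {y} x~y with (x Fin.≟ a) ×-dec (y Fin.≟ u) | (x Fin.≟ u) ×-dec (y Fin.≟ a)
    ... | yes ≡au | _ = inj₂ (inj₁ ≡au)
    ... | no _ | yes ≡ua = inj₂ (inj₂ ≡ua)
    ... | no ≢au | no ≢ua = inj₁ (x~y , ≢au , ≢ua)
  -- Here `u` has at most a loop in `S`. It is attached to an arbitrary `z` by a pair without an
  -- edge between them, and `realised-close` moves the in-label from `z` to `u` with no pendant
  -- edge, as `z` and `u` are not adjacent.
  ... | yes (z , z∈S , z≢u) | no isolated =
          realised-close ~-sym _~?_ ~-sym _~?_ z∈S u∈S id (λ _ _ → inj₁)
            (realised-series cover ~-sym _~?_ meet
              (Realisable.closed (IH (S₂⊆S , u , u∈S , λ u∈ → S₂≢u u∈ refl)) z∈S₂)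
              (realised-pair G ~-sym _~?_))
    where
    S₂ : Subset n
    S₂ = minus G S u
    S₂⊆S : S₂ ⊆ S
    S₂⊆S = proj₁ ∘ ∈-comprehension⁻ (minus? G S u)
    S₂≢u : ∀ {x} → x ∈ S₂ → x ≢ u
    S₂≢u = proj₂ ∘ ∈-comprehension⁻ (minus? G S u)
    z∈S₂ : z ∈ S₂
    z∈S₂ = ∈-comprehension⁺ (minus? G S u) (z∈S , z≢u)
    pair⁻ : ∀ {x} → x ∈ ⁅ z ⁆ ∪ ⁅ u ⁆ → x ≡ z ⊎ x ≡ u
    pair⁻ x∈ = Sum.map (x∈⁅y⁆⇒x≡y z) (x∈⁅y⁆⇒x≡y u) (x∈p∪q⁻ ⁅ z ⁆ ⁅ u ⁆ x∈)
    at-u : u ∈ ⁅ z ⁆ ∪ ⁅ u ⁆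
    at-u = x∈p∪q⁺ (inj₂ (x∈⁅x⁆ u))
    meet : ∀ {x} → x ∈ S₂ → x ∈ ⁅ z ⁆ ∪ ⁅ u ⁆ → x ≡ z
    meet x∈S₂ x∈ = [ id , (λ x≡u → contradiction x≡u (S₂≢u x∈S₂)) ]′ (pair⁻ x∈)
    edges : ∀ {x y} → x ∈ S → y ∈ S → x ~ y →
            (x ∈ S₂ × y ∈ S₂ × x ~ y) ⊎ (x ∈ ⁅ z ⁆ ∪ ⁅ u ⁆ × y ∈ ⁅ z ⁆ ∪ ⁅ u ⁆ × x ~ y)
    edges {x} {y} x∈S y∈S x~y with x Fin.≟ u | y Fin.≟ u
    ... | yes refl | yes refl = inj₂ (at-u , at-u , x~y)
    ... | yes refl | no y≢u = contradiction (y , (y∈S , y≢u) , ~-sym x~y) isolated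
    ... | no x≢u | yes refl = contradiction (x , (x∈S , x≢u) , x~y) isolated
    ... | no x≢u | no y≢u = inj₁ (∈-comprehension⁺ (minus? G S u) (x∈S , x≢u) ,
                                  ∈-comprehension⁺ (minus? G S u) (y∈S , y≢u) , x~y)
    cover-u : ∀ {x} → x ∈ S → x ∈ S₂ ⊎ x ∈ ⁅ z ⁆ ∪ ⁅ u ⁆
    cover-u {x} x∈S with x Fin.≟ u
    ... | yes refl = inj₂ at-u
    ... | no x≢u = inj₁ (∈-comprehension⁺ (minus? G S u) (x∈S , x≢u))
    cover : Cover (Adj G) S₂ (Adj G) (⁅ z ⁆ ∪ ⁅ u ⁆) (Adj G) S
    cover = record
      { ⊆₁ = S₂⊆S ; ⊆₂ = λ x∈ → [ (λ { refl → z∈S }) , (λ { refl → u∈S }) ]′ (pair⁻ x∈)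
      ; cover = cover-u ; edges₁ = λ _ _ → id ; edges₂ = λ _ _ → id ; edges = edges }

  realise-opened : ∀ {S u v} → u ∈ S → v ∈ S → u ≢ v → Ext G S u v → Smaller S → Realised (Adj G) S u v
  realise-opened u∈S v∈S u≢v X IH with split-or-links G u∈S v∈S u≢v
  ... | inj₁ split = restore-edge G u∈S v∈S (realise-split G u∈S v∈S u≢v split (inj₁ X) IH)
  ... | inj₂ links = contradiction (links⇒K₂,₃ G u∈S v∈S u≢v X links) (proj₂ outerplanar)

  realisable : ∀ {S} → Acc _⊂_ S → Realisable G S
  realisable (acc rec) = record
    { closed = λ u∈S → realise-closed u∈S (λ S′⊂S → realisable (rec S′⊂S))
    ; opened = λ u∈S v∈S u≢v X → realise-opened u∈S v∈S u≢v X (λ S′⊂S → realisable (rec S′⊂S)) }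

  outerplanar⇒L₁ : UnderliesL₁ G
  outerplanar⇒L₁ = F , proj₂ whole , record
    { bijection = mk↔ₛ′ embed (λ x → proj₁ (onto {x} ∈⊤)) (λ x → proj₂ (onto {x} ∈⊤))
                        (λ x → injective (proj₂ (onto ∈⊤)))
    ; adjacency = adjacency }
    where
    whole : ∃ λ P → L₁ (Piece.F P)
    whole = Realisable.closed (realisable (⊂-wellFounded _)) {vertex (Graph.nonEmpty G)} ∈⊤
      where
      vertex : ∀ {m} → NonZero m → Fin m
      vertex {suc _} _ = zero
    open Piece (proj₁ whole)

theorem4p21 : ∀ (G : Graph) → UnderliesL₁ G ⇔ Outerplanar G
theorem4p21 G = mk⇔ L₁⇒outerplanar outerplanar⇒L₁
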